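{- Let $P\in\mathbb{Z}[x]$ be a monic polynomial of degree $2$ or $3$ and let $\alpha\in\mathbb{R}$, $\alpha\ge 0$. For all $\epsilon>0$ there exist $n,d_1,d_2\in\mathbb{Z}$, which can be computed explicitly, such that $$P(n)=d_1d_2\quad\text{and}\quad \left|\frac{d_1}{d_2}-\alpha\right|<\epsilon.$$
   Context: The ratio $d_1/d_2$ is understood to be defined, i.e. $d_2\neq 0$. -}

module Defs where

open import Data.Integer.Base as ℤ using (ℤ; +_; 0ℤ; 1ℤ)
open import Data.Integer.GCD using (gcd)
open import Data.List.Base using (List; []; _∷_)
open import Data.Nat.Base as ℕ using (ℕ; zero; suc)
open import Data.Product.Base using (_×_; ∃-syntax)
open import Data.Rational.Base as ℚ using (ℚ; 0ℚ)
import Data.Rational.Properties as ℚ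
import Data.Rational.Unnormalised.Base as ℚᵘ
import Data.Rational.Unnormalised.Properties as ℚᵘ
open import Data.Rational.Solver using (module +-*-Solver)
open import Data.Integer.Solver using () renaming (module +-*-Solver to ℤ-Solver)
open import Data.Sum.Base using (inj₁; inj₂)
open import Relation.Binary.PropositionalEquality

-- ℤ[x]: coefficients in order of increasing degree.  Trailing zeros are
-- allowed, so the length of the list does not determine the degree.

ℤ[x] : Set
ℤ[x] = List ℤ

coeff : ℤ[x] → ℕ → ℤ
coeff []      _       = 0ℤ
coeff (a ∷ P) zero    = a
coeff (a ∷ P) (suc k) = coeff P k

eval : ℤ[x] → ℤ → ℤ
eval []      n = 0ℤ
eval (a ∷ P) n = a ℤ.+ n ℤ.* eval P n

HasDegree : ℤ[x] → ℕ → Set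
HasDegree P d = coeff P d ≢ 0ℤ × (∀ k → d ℕ.< k → coeff P k ≡ 0ℤ)

Monic : ℤ[x] → Set
Monic P = ∃[ d ] (HasDegree P d × coeff P d ≡ 1ℤ)

fromℤ : ℤ → ℚ
fromℤ i = i ℚ./ 1

fromℤ-nonZero : ∀ i → .{{ℤ.NonZero i}} → ℚ.NonZero (fromℤ i)
fromℤ-nonZero i = ℚ.≢-nonZero {fromℤ i} λ i/1≡0 →
  ℕ.≢-nonZero⁻¹ ℤ.∣ i ∣ (cong ℤ.∣_∣
    (trans (sym (ℚ.↥-/ i 1)) (cong (λ q → ℚ.↥ q ℤ.* gcd i 1ℤ) i/1≡0)))

quotient : (d₁ d₂ : ℤ) → .{{ℤ.NonZero d₂}} → ℚ
quotient d₁ d₂ = ℚ._÷_ (fromℤ d₁) (fromℤ d₂) {{fromℤ-nonZero d₂}}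

-- Real numbers in the sense of Bishop: regular sequences of rationals.
-- Indices start at 0, so Bishop's bound 1/n becomes 1/(n+1).

1/[1+_] : ℕ → ℚ
1/[1+ n ] = + 1 ℚ./ suc n

record ℝ : Set where
  constructor mkℝ
  field
    seq     : ℕ → ℚ
    regular : ∀ m n → ℚ.∣ seq m ℚ.- seq n ∣ ℚ.≤ 1/[1+ m ] ℚ.+ 1/[1+ n ]

open ℝ public

private
  0≤1/[1+_] : ∀ n → 0ℚ ℚ.≤ 1/[1+ n ]
  0≤1/[1+ n ] = ℚ.nonNegative⁻¹ 1/[1+ n ] {{ℚ.normalize-nonNeg 1 (suc n)}}

fromℚ : ℚ → ℝ
seq     (fromℚ q) _   = q
regular (fromℚ q) m n = begin
  ℚ.∣ q ℚ.- q ∣               ≡⟨ cong ℚ.∣_∣ (ℚ.+-inverseʳ q) ⟩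
  0ℚ                          ≤⟨ ℚ.+-mono-≤ 0≤1/[1+ m ] 0≤1/[1+ n ] ⟩
  1/[1+ m ] ℚ.+ 1/[1+ n ]     ∎
  where open ℚ.≤-Reasoning

0ℝ : ℝ
0ℝ = fromℚ 0ℚ

-- n ↦ 2n+1 is the 0-based form of n ↦ 2n; by double-half it is what makes
-- a termwise difference regular.

double : ℕ → ℕ
double n = suc (n ℕ.+ n)

private
  double-half : ∀ n → 1/[1+ double n ] ℚ.+ 1/[1+ double n ] ≡ 1/[1+ n ]
  double-half n = begin
    ℚ.fromℚᵘ u ℚ.+ ℚ.fromℚᵘ u ≡⟨ ℚ.toℚᵘ-injective (ℚᵘ.≃-trans
                                    (ℚ.toℚᵘ-homo-+ (ℚ.fromℚᵘ u) (ℚ.fromℚᵘ u))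
                                    (ℚᵘ.≃-trans
                                      (ℚᵘ.+-cong (ℚ.toℚᵘ-fromℚᵘ u) (ℚ.toℚᵘ-fromℚᵘ u))
                                      (ℚᵘ.≃-sym (ℚ.toℚᵘ-fromℚᵘ (u ℚᵘ.+ u))))) ⟩
    ℚ.fromℚᵘ (u ℚᵘ.+ u)       ≡⟨ ℚ.fromℚᵘ-cong {u ℚᵘ.+ u} {ℚᵘ.mkℚᵘ (+ 1) n} (ℚᵘ.*≡* lemma) ⟩
    ℚ.fromℚᵘ (ℚᵘ.mkℚᵘ (+ 1) n) ∎
    where
    open ≡-Reasoning
    u = ℚᵘ.mkℚᵘ (+ 1) (double n)
    lemma : (+ 1 ℤ.* + suc (double n) ℤ.+ + 1 ℤ.* + suc (double n)) ℤ.* + suc n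
          ≡ + 1 ℤ.* (+ suc (double n) ℤ.* + suc (double n))
    lemma = ℤ-Solver.solve 1
      (λ x → let open ℤ-Solver
                 s = con (+ 1) :+ x
                 t = con (+ 2) :+ (x :+ x)
             in (con (+ 1) :* t :+ con (+ 1) :* t) :* s := con (+ 1) :* (t :* t))
      refl (+ n)

  rearrange : ∀ a b c d → (a ℚ.- b) ℚ.- (c ℚ.- d) ≡ (a ℚ.- c) ℚ.- (b ℚ.- d)
  rearrange = solve 4 (λ a b c d → (a :- b) :- (c :- d) := (a :- c) :- (b :- d)) refl
    where open +-*-Solver

  interchange : ∀ a b → (a ℚ.+ b) ℚ.+ (a ℚ.+ b) ≡ (a ℚ.+ a) ℚ.+ (b ℚ.+ b)
  interchange = solve 2 (λ a b → (a :+ b) :+ (a :+ b) := (a :+ a) :+ (b :+ b)) refl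
    where open +-*-Solver

infixl 6 _-_

_-_ : ℝ → ℝ → ℝ
seq     (x - y) n   = seq x (double n) ℚ.- seq y (double n)
regular (x - y) m n = begin
  ℚ.∣ (x′ m ℚ.- y′ m) ℚ.- (x′ n ℚ.- y′ n) ∣
    ≡⟨ cong ℚ.∣_∣ (rearrange (x′ m) (y′ m) (x′ n) (y′ n)) ⟩
  ℚ.∣ (x′ m ℚ.- x′ n) ℚ.- (y′ m ℚ.- y′ n) ∣
    ≤⟨ ℚ.∣p-q∣≤∣p∣+∣q∣ (x′ m ℚ.- x′ n) (y′ m ℚ.- y′ n) ⟩
  ℚ.∣ x′ m ℚ.- x′ n ∣ ℚ.+ ℚ.∣ y′ m ℚ.- y′ n ∣
    ≤⟨ ℚ.+-mono-≤ (regular x (double m) (double n)) (regular y (double m) (double n)) ⟩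
  (h m ℚ.+ h n) ℚ.+ (h m ℚ.+ h n)
    ≡⟨ interchange (h m) (h n) ⟩
  (h m ℚ.+ h m) ℚ.+ (h n ℚ.+ h n)
    ≡⟨ cong₂ ℚ._+_ (double-half m) (double-half n) ⟩
  1/[1+ m ] ℚ.+ 1/[1+ n ] ∎
  where
  open ℚ.≤-Reasoning
  x′ y′ h : ℕ → ℚ
  x′ k = seq x (double k)
  y′ k = seq y (double k)
  h  k = 1/[1+ double k ]

private
  ∣p∣-∣q∣≤∣p-q∣ : ∀ p q → ℚ.∣ p ∣ ℚ.- ℚ.∣ q ∣ ℚ.≤ ℚ.∣ p ℚ.- q ∣
  ∣p∣-∣q∣≤∣p-q∣ p q = begin
    ℚ.∣ p ∣ ℚ.- ℚ.∣ q ∣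
      ≡⟨ cong (λ r → ℚ.∣ r ∣ ℚ.- ℚ.∣ q ∣) (solve 2 (λ a b → a := (a :- b) :+ b) refl p q) ⟩
    ℚ.∣ (p ℚ.- q) ℚ.+ q ∣ ℚ.- ℚ.∣ q ∣
      ≤⟨ ℚ.+-monoˡ-≤ (ℚ.- ℚ.∣ q ∣) (ℚ.∣p+q∣≤∣p∣+∣q∣ (p ℚ.- q) q) ⟩
    (ℚ.∣ p ℚ.- q ∣ ℚ.+ ℚ.∣ q ∣) ℚ.- ℚ.∣ q ∣
      ≡⟨ solve 2 (λ a b → (a :+ b) :- b := a) refl ℚ.∣ p ℚ.- q ∣ ℚ.∣ q ∣ ⟩
    ℚ.∣ p ℚ.- q ∣ ∎
    where
    open ℚ.≤-Reasoning
    open +-*-Solver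

  ∣-∣-flip : ∀ p q → ℚ.∣ q ℚ.- p ∣ ≡ ℚ.∣ p ℚ.- q ∣
  ∣-∣-flip p q = trans
    (cong ℚ.∣_∣ (solve 2 (λ a b → b :- a := :- (a :- b)) refl p q))
    (ℚ.∣-p∣≡∣p∣ (p ℚ.- q))
    where open +-*-Solver

  ∣∣p∣-∣q∣∣≤∣p-q∣ : ∀ p q → ℚ.∣ ℚ.∣ p ∣ ℚ.- ℚ.∣ q ∣ ∣ ℚ.≤ ℚ.∣ p ℚ.- q ∣
  ∣∣p∣-∣q∣∣≤∣p-q∣ p q with ℚ.∣p∣≡p∨∣p∣≡-p (ℚ.∣ p ∣ ℚ.- ℚ.∣ q ∣)
  ... | inj₁ eq = ℚ.≤-trans (ℚ.≤-reflexive eq) (∣p∣-∣q∣≤∣p-q∣ p q)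
  ... | inj₂ eq = begin
    ℚ.∣ ℚ.∣ p ∣ ℚ.- ℚ.∣ q ∣ ∣     ≡⟨ eq ⟩
    ℚ.- (ℚ.∣ p ∣ ℚ.- ℚ.∣ q ∣)     ≡⟨ solve 2 (λ a b → :- (a :- b) := b :- a) refl ℚ.∣ p ∣ ℚ.∣ q ∣ ⟩
    ℚ.∣ q ∣ ℚ.- ℚ.∣ p ∣           ≤⟨ ∣p∣-∣q∣≤∣p-q∣ q p ⟩
    ℚ.∣ q ℚ.- p ∣                 ≡⟨ ∣-∣-flip p q ⟩
    ℚ.∣ p ℚ.- q ∣                 ∎
    where
    open ℚ.≤-Reasoning
    open +-*-Solver

∣_∣ : ℝ → ℝ
seq     ∣ x ∣ n   = ℚ.∣ seq x n ∣
regular ∣ x ∣ m n = ℚ.≤-trans (∣∣p∣-∣q∣∣≤∣p-q∣ (seq x m) (seq x n)) (regular x m n)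

Positive : ℝ → Set
Positive x = ∃[ n ] 1/[1+ n ] ℚ.< seq x n

NonNegative : ℝ → Set
NonNegative x = ∀ n → ℚ.- 1/[1+ n ] ℚ.≤ seq x n

infix 4 _<_ _≤_

_<_ : ℝ → ℝ → Set
x < y = Positive (y - x)

_≤_ : ℝ → ℝ → Set
x ≤ y = NonNegative (y - x)

-- Let F(x, y) = yᵏ P(x / y) with k = deg P.  If n ≡ x / y mod F(x, y) then
-- F(x, y) divides P(n), and a small such n gives a cofactor of comparable size.
--
-- k = 2: for coprime m, v take (e, x) with v e − m x = 1.  Then F(e, m) F(x, v)
-- is a value of P, and F(e, m) / F(x, v) → (m / v)² as (e, x) runs to infinity
-- along the solutions.
--
-- k = 3: if x² ≡ 1 mod y then n = (x − F(x, y)) / y is an integer, and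
-- P(n) / F(x, y)² = − P(x / y) + O(y⁻²).  For coprime j, v the choice
-- x = 1 + 2 j u, y = 2 u v with v w − j u = 1 has x / y = j / v + 1 / y → j / v.
--
-- The limits ρ² and − P(ρ), ρ rational, are dense in (0, ∞) by the
-- intermediate value theorem.

module Submission where

open import Defs using (fromℤ; 1/[1+_]; quotient)
open import Data.Integer.Base as ℤ using (ℤ; +_; -[1+_]; 0ℤ; 1ℤ)
import Data.Integer.Properties as ℤ
open import Data.Integer.Solver using () renaming (module +-*-Solver to ℤ-Solver)
open import Data.List.Base using ([]; _∷_)
open import Data.Nat.Base as ℕ using (ℕ; zero; suc)
import Data.Nat.Coprimality as Coprimality
open import Data.Nat.GCD using (module Bézout)
import Data.Nat.Properties as ℕ
open import Data.Product.Base using (∃-syntax; Σ-syntax; _×_; _,_; proj₂)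
open import Data.Rational.Base as ℚ using (ℚ; 0ℚ; 1ℚ; mkℚ)
import Data.Rational.Properties as ℚ
open import Data.Rational.Solver using (module +-*-Solver)
import Data.Rational.Unnormalised.Base as ℚᵘ
import Data.Rational.Unnormalised.Properties as ℚᵘ
open import Data.Sum.Base using (_⊎_; inj₁; inj₂)
open import Function.Base using (_∘_; _$_)
open import Relation.Binary.Definitions using (tri<; tri≈; tri>)
open import Relation.Binary.PropositionalEquality
open import Relation.Nullary using (yes; no; contradiction)

-- In the cubic case `x² ≡ 1` gives `F(x, y) ≡ x³ ≡ x` mod `y`, whence the integrality of `n`. Since
-- `n` is close to `−F/y`, the value `P(n)` is close to `−F³/y³`; dividing by `F²` leaves `−P(x/y)`,
-- which is where the sign comes from. The limit can be taken only where `P(ρ) ≠ 0`, so positive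
-- targets are approximated from above.
--
-- Both limits reduce to one statement. With `η = 1/x` (quadratic) or `η = 1/y` (cubic), each factor
-- is a common power of `x` or `y` times a polynomial in `η`, and the ratio of the two polynomials
-- at `η = 0` is the limit.
--
-- Everything has to be computable. An exact intermediate value is out of reach constructively, but
-- an approximate one at a rational point is enough, and comparison of rationals is decidable. The
-- real number `α` enters only at the end, through a strictly positive rational near it; this also
-- covers `α = 0`.

-- The embedding of the integers into the rationals.

module Embedding where

  toℚᵘ-fromℤ : ∀ i → ℚ.toℚᵘ (fromℤ i) ℚᵘ.≃ ℚᵘ.mkℚᵘ i 0
  toℚᵘ-fromℤ i = ℚ.toℚᵘ-fromℚᵘ (ℚᵘ.mkℚᵘ i 0)

  fromℤ-+ : ∀ i j → fromℤ (i ℤ.+ j) ≡ fromℤ i ℚ.+ fromℤ j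
  fromℤ-+ i j = ℚ.toℚᵘ-injective $ begin
    ℚ.toℚᵘ (fromℤ (i ℤ.+ j))                 ≈⟨ toℚᵘ-fromℤ (i ℤ.+ j) ⟩
    ℚᵘ.mkℚᵘ (i ℤ.+ j) 0
      ≈⟨ ℚᵘ.*≡* (cong (ℤ._* 1ℤ) (sym (cong₂ ℤ._+_ (ℤ.*-identityʳ i) (ℤ.*-identityʳ j)))) ⟩
    ℚᵘ.mkℚᵘ i 0 ℚᵘ.+ ℚᵘ.mkℚᵘ j 0             ≈⟨ ℚᵘ.+-cong (toℚᵘ-fromℤ i) (toℚᵘ-fromℤ j) ⟨
    ℚ.toℚᵘ (fromℤ i) ℚᵘ.+ ℚ.toℚᵘ (fromℤ j)   ≈⟨ ℚ.toℚᵘ-homo-+ (fromℤ i) (fromℤ j) ⟨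
    ℚ.toℚᵘ (fromℤ i ℚ.+ fromℤ j)             ∎
    where open ℚᵘ.≃-Reasoning

  fromℤ-* : ∀ i j → fromℤ (i ℤ.* j) ≡ fromℤ i ℚ.* fromℤ j
  fromℤ-* i j = ℚ.toℚᵘ-injective $ begin
    ℚ.toℚᵘ (fromℤ (i ℤ.* j))                 ≈⟨ toℚᵘ-fromℤ (i ℤ.* j) ⟩
    ℚᵘ.mkℚᵘ i 0 ℚᵘ.* ℚᵘ.mkℚᵘ j 0             ≈⟨ ℚᵘ.*-cong (toℚᵘ-fromℤ i) (toℚᵘ-fromℤ j) ⟨
    ℚ.toℚᵘ (fromℤ i) ℚᵘ.* ℚ.toℚᵘ (fromℤ j)   ≈⟨ ℚ.toℚᵘ-homo-* (fromℤ i) (fromℤ j) ⟨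
    ℚ.toℚᵘ (fromℤ i ℚ.* fromℤ j)             ∎
    where open ℚᵘ.≃-Reasoning

  fromℤ-neg : ∀ i → fromℤ (ℤ.- i) ≡ ℚ.- fromℤ i
  fromℤ-neg i = ℚ.toℚᵘ-injective $ begin
    ℚ.toℚᵘ (fromℤ (ℤ.- i))     ≈⟨ toℚᵘ-fromℤ (ℤ.- i) ⟩
    ℚᵘ.- ℚᵘ.mkℚᵘ i 0           ≈⟨ ℚᵘ.-‿cong (toℚᵘ-fromℤ i) ⟨
    ℚᵘ.- ℚ.toℚᵘ (fromℤ i)      ≈⟨ ℚ.toℚᵘ-homo‿- (fromℤ i) ⟨
    ℚ.toℚᵘ (ℚ.- fromℤ i)       ∎
    where open ℚᵘ.≃-Reasoning

  denominator-clears : ∀ q → fromℤ (ℚ.↧ q) ℚ.* q ≡ fromℤ (ℚ.↥ q)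
  denominator-clears q@(mkℚ n d-1 _) = ℚ.toℚᵘ-injective $ begin
    ℚ.toℚᵘ (fromℤ (ℚ.↧ q) ℚ.* q)             ≈⟨ ℚ.toℚᵘ-homo-* (fromℤ (ℚ.↧ q)) q ⟩
    ℚ.toℚᵘ (fromℤ (ℚ.↧ q)) ℚᵘ.* ℚ.toℚᵘ q     ≈⟨ ℚᵘ.*-congʳ (toℚᵘ-fromℤ (ℚ.↧ q)) ⟩
    ℚᵘ.mkℚᵘ (ℚ.↧ q) 0 ℚᵘ.* ℚᵘ.mkℚᵘ n d-1     ≈⟨ ℚᵘ.*≡* (cross n d-1) ⟩
    ℚᵘ.mkℚᵘ n 0                              ≈⟨ toℚᵘ-fromℤ n ⟨
    ℚ.toℚᵘ (fromℤ (ℚ.↥ q))                   ∎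
    where
    open ℚᵘ.≃-Reasoning
    cross : ∀ n d-1 → (+ suc d-1 ℤ.* n) ℤ.* 1ℤ ≡ n ℤ.* + suc (d-1 ℕ.+ 0)
    cross n d-1 = trans (ℤ.*-identityʳ _) (trans (ℤ.*-comm (+ suc d-1) n)
      (cong (λ k → n ℤ.* + suc k) (sym (ℕ.+-identityʳ d-1))))

  fromℤ-1/ : ∀ k → fromℤ (+ suc k) ℚ.* 1/[1+ k ] ≡ 1ℚ
  fromℤ-1/ k = ℚ.toℚᵘ-injective $ begin
    ℚ.toℚᵘ (fromℤ (+ suc k) ℚ.* 1/[1+ k ])
      ≈⟨ ℚ.toℚᵘ-homo-* (fromℤ (+ suc k)) 1/[1+ k ] ⟩
    ℚ.toℚᵘ (fromℤ (+ suc k)) ℚᵘ.* ℚ.toℚᵘ 1/[1+ k ]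
      ≈⟨ ℚᵘ.*-cong (toℚᵘ-fromℤ (+ suc k)) (ℚ.toℚᵘ-fromℚᵘ (ℚᵘ.mkℚᵘ (+ 1) k)) ⟩
    ℚᵘ.mkℚᵘ (+ suc k) 0 ℚᵘ.* ℚᵘ.mkℚᵘ (+ 1) k
      ≈⟨ ℚᵘ.*≡* (cong +_ (cong suc (lemma k))) ⟩
    ℚ.toℚᵘ 1ℚ ∎
    where
    open ℚᵘ.≃-Reasoning
    lemma : ∀ k → k ℕ.* 1 ℕ.* 1 ≡ k ℕ.+ 0 ℕ.+ 0
    lemma k = trans (trans (ℕ.*-identityʳ _) (ℕ.*-identityʳ k)) (sym (trans (ℕ.+-identityʳ _) (ℕ.+-identityʳ k)))

  fromℤ-mono-≤ : ∀ {i j} → i ℤ.≤ j → fromℤ i ℚ.≤ fromℤ j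
  fromℤ-mono-≤ {i} {j} i≤j = ℚ.toℚᵘ-cancel-≤ $ begin
    ℚ.toℚᵘ (fromℤ i)   ≃⟨ toℚᵘ-fromℤ i ⟩
    ℚᵘ.mkℚᵘ i 0        ≤⟨ ℚᵘ.*≤* (ℤ.*-monoʳ-≤-nonNeg 1ℤ i≤j) ⟩
    ℚᵘ.mkℚᵘ j 0        ≃⟨ toℚᵘ-fromℤ j ⟨
    ℚ.toℚᵘ (fromℤ j)   ∎
    where open ℚᵘ.≤-Reasoning

  0<1/[1+_] : ∀ k → 0ℚ ℚ.< 1/[1+ k ]
  0<1/[1+ k ] = ℚ.positive⁻¹ 1/[1+ k ] {{ℚ.normalize-pos 1 (suc k)}}

  1/-antimono : ∀ {m n} → m ℕ.≤ n → 1/[1+ n ] ℚ.≤ 1/[1+ m ]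
  1/-antimono {m} {n} m≤n = ℚ.toℚᵘ-cancel-≤ $ begin
    ℚ.toℚᵘ 1/[1+ n ]    ≃⟨ ℚ.toℚᵘ-fromℚᵘ (ℚᵘ.mkℚᵘ (+ 1) n) ⟩
    ℚᵘ.mkℚᵘ (+ 1) n     ≤⟨ ℚᵘ.*≤* (ℤ.*-monoˡ-≤-nonNeg 1ℤ (ℤ.+≤+ (ℕ.s≤s m≤n))) ⟩
    ℚᵘ.mkℚᵘ (+ 1) m     ≃⟨ ℚ.toℚᵘ-fromℚᵘ (ℚᵘ.mkℚᵘ (+ 1) m) ⟨
    ℚ.toℚᵘ 1/[1+ m ]    ∎
    where open ℚᵘ.≤-Reasoning

  below-integer : ∀ q → q ℚ.< fromℤ (+ suc ℤ.∣ ℚ.↥ q ∣)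
  below-integer q@(mkℚ n d-1 _) = ℚ.toℚᵘ-cancel-< $ begin-strict
    ℚᵘ.mkℚᵘ n d-1                         <⟨ ℚᵘ.*<* (lemma n) ⟩
    ℚᵘ.mkℚᵘ (+ suc ℤ.∣ n ∣) 0             ≃⟨ toℚᵘ-fromℤ (+ suc ℤ.∣ n ∣) ⟨
    ℚ.toℚᵘ (fromℤ (+ suc ℤ.∣ n ∣))        ∎
    where
    open ℚᵘ.≤-Reasoning
    lemma : ∀ n → n ℤ.* 1ℤ ℤ.< + suc ℤ.∣ n ∣ ℤ.* + suc d-1
    lemma (+ n) rewrite ℤ.*-identityʳ (+ n) | sym (ℤ.pos-* (suc n) (suc d-1)) =
      ℤ.+<+ (ℕ.m≤m*n (suc n) (suc d-1))
    lemma (ℤ.-[1+ n ]) rewrite ℤ.*-identityʳ (ℤ.-[1+ n ]) | sym (ℤ.pos-* (suc (suc n)) (suc d-1)) = ℤ.-<+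

open Embedding

-- Inequalities and absolute values in the rationals.

module OrderedField where

  open import Data.Rational.Base
  open ℚ.≤-Reasoning
  open +-*-Solver

  *-mono-≤ : ∀ {p q r s} → 0ℚ ≤ p → p ≤ q → 0ℚ ≤ r → r ≤ s → p * r ≤ q * s
  *-mono-≤ {p} {q} {r} {s} 0≤p p≤q 0≤r r≤s = begin
    p * r ≤⟨ ℚ.*-monoʳ-≤-nonNeg r {{nonNegative 0≤r}} p≤q ⟩
    q * r ≤⟨ ℚ.*-monoˡ-≤-nonNeg q {{nonNegative (ℚ.≤-trans 0≤p p≤q)}} r≤s ⟩
    q * s ∎

  *-pos : ∀ {p q} → 0ℚ < p → 0ℚ < q → 0ℚ < p * q
  *-pos {p} {q} 0<p 0<q =
    ℚ.positive⁻¹ (p * q) {{ℚ.pos*pos⇒pos p {{positive 0<p}} q {{positive 0<q}}}}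

  p≤∣p∣ : ∀ p → p ≤ ∣ p ∣
  p≤∣p∣ p with ℚ.≤-total 0ℚ p
  ... | inj₁ 0≤p = ℚ.≤-reflexive (sym (ℚ.0≤p⇒∣p∣≡p 0≤p))
  ... | inj₂ p≤0 = ℚ.≤-trans p≤0 (ℚ.0≤∣p∣ p)

  ∣-∣-pos : ∀ {p} → p ≢ 0ℚ → 0ℚ < ∣ p ∣
  ∣-∣-pos {p} p≢0 with ℚ.<-cmp 0ℚ ∣ p ∣
  ... | tri< 0<∣p∣ _ _ = 0<∣p∣
  ... | tri≈ _ 0≡∣p∣ _ = contradiction (ℚ.∣p∣≡0⇒p≡0 p (sym 0≡∣p∣)) p≢0
  ... | tri> _ _ ∣p∣<0 = contradiction (ℚ.<-≤-trans ∣p∣<0 (ℚ.0≤∣p∣ p)) (ℚ.<-irrefl refl)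

  ∣-∣-sub-comm : ∀ p q → ∣ p - q ∣ ≡ ∣ q - p ∣
  ∣-∣-sub-comm p q = trans
    (cong ∣_∣ (solve 2 (λ p q → p :- q := :- (q :- p)) refl p q)) (ℚ.∣-p∣≡∣p∣ (q - p))

  ∣-∣-triangle : ∀ p q r → ∣ p - r ∣ ≤ ∣ p - q ∣ + ∣ q - r ∣
  ∣-∣-triangle p q r = begin
    ∣ p - r ∣               ≡⟨ cong ∣_∣ (solve 3 (λ p q r → p :- r := (p :- q) :+ (q :- r)) refl p q r) ⟩
    ∣ (p - q) + (q - r) ∣   ≤⟨ ℚ.∣p+q∣≤∣p∣+∣q∣ (p - q) (q - r) ⟩
    ∣ p - q ∣ + ∣ q - r ∣   ∎

  ≤+⇒-≤ : ∀ {p q r} → p ≤ q + r → p - q ≤ r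
  ≤+⇒-≤ {p} {q} {r} p≤q+r = begin
    p - q         ≤⟨ ℚ.+-monoˡ-≤ (- q) p≤q+r ⟩
    (q + r) - q   ≡⟨ solve 2 (λ q r → (q :+ r) :- q := r) refl q r ⟩
    r             ∎

  p≤q⇒0≤q-p : ∀ {p q} → p ≤ q → 0ℚ ≤ q - p
  p≤q⇒0≤q-p {p} {q} p≤q = begin
    0ℚ      ≡⟨ ℚ.+-inverseʳ p ⟨
    p - p   ≤⟨ ℚ.+-monoˡ-≤ (- p) p≤q ⟩
    q - p   ∎

  halves : ∀ p → p ≡ ½ * p + ½ * p
  halves p = trans (sym (ℚ.*-identityˡ p)) (ℚ.*-distribʳ-+ p ½ ½)

  half-pos : ∀ {p} → 0ℚ < p → 0ℚ < ½ * p
  half-pos = *-pos (ℚ.positive⁻¹ ½)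

  -- `C` may have either sign, because the Lipschitz constants below come without sign information;
  -- the proof passes to `∣ C ∣`. The witness is the absolute value of the numerator of `∣ C ∣ / δ`,
  -- and `K + 1` exceeds that fraction since its denominator is at least 1.
  archimedean : ∀ C {δ} → 0ℚ < δ →
    ∃[ K ] (∀ {t} → 0ℚ ≤ t → t ≤ 1/[1+ K ] → C * t < δ)
  archimedean C {δ} 0<δ = K , λ {t} 0≤t t≤ → begin-strict
    C * t               ≤⟨ ℚ.*-monoʳ-≤-nonNeg t {{nonNegative 0≤t}} (p≤∣p∣ C) ⟩
    ∣ C ∣ * t           ≤⟨ ℚ.*-monoˡ-≤-nonNeg ∣ C ∣ {{ℚ.∣-∣-nonNeg C}} t≤ ⟩
    ∣ C ∣ * 1/[1+ K ]   ≡⟨ cong (_* 1/[1+ K ]) C≡q*δ ⟩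
    (q * δ) * 1/[1+ K ] <⟨ ℚ.*-monoˡ-<-pos 1/[1+ K ] {{positive 0<1/[1+ K ]}}
                             (ℚ.*-monoˡ-<-pos δ {{δ-pos}} (below-integer q)) ⟩
    (fromℤ (+ suc K) * δ) * 1/[1+ K ]
                        ≡⟨ solve 3 (λ k δ u → (k :* δ) :* u := (k :* u) :* δ) refl
                             (fromℤ (+ suc K)) δ 1/[1+ K ] ⟩
    (fromℤ (+ suc K) * 1/[1+ K ]) * δ
                        ≡⟨ trans (cong (_* δ) (fromℤ-1/ K)) (ℚ.*-identityˡ δ) ⟩
    δ                   ∎
    where
    instance
      δ-pos = positive 0<δ
      δ-nonZero = ℚ.pos⇒nonZero δ
    q = ∣ C ∣ * 1/ δ
    K = ℤ.∣ ↥ q ∣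
    C≡q*δ : ∣ C ∣ ≡ q * δ
    C≡q*δ = sym (trans (ℚ.*-assoc ∣ C ∣ (1/ δ) δ)
      (trans (cong (∣ C ∣ *_) (ℚ.*-inverseˡ δ)) (ℚ.*-identityʳ ∣ C ∣)))

open OrderedField

-- Locally Lipschitz functions: limits of quotients and intermediate values.

module LocallyLipschitz where

  open import Data.Rational.Base
  open ℚ.≤-Reasoning
  open +-*-Solver

  -- Stable under the ring operations, and strong enough both for an explicit
  -- modulus of continuity at 0 and for a constructive intermediate value theorem.
  record LocLip (f : ℚ → ℚ) : Set where
    field on : ∀ R → ∃[ B ] ∃[ C ] (∀ x y → ∣ x ∣ ≤ R → ∣ y ∣ ≤ R →
            ∣ f x ∣ ≤ B × ∣ f x - f y ∣ ≤ C * ∣ x - y ∣)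

  open LocLip

  const-LocLip : ∀ c → LocLip (λ _ → c)
  const-LocLip c .on R = ∣ c ∣ , 0ℚ , λ x y _ _ → ℚ.≤-refl , (begin
    ∣ c - c ∣        ≡⟨ cong ∣_∣ (ℚ.+-inverseʳ c) ⟩
    0ℚ               ≡⟨ ℚ.*-zeroˡ ∣ x - y ∣ ⟨
    0ℚ * ∣ x - y ∣   ∎)

  id-LocLip : LocLip (λ x → x)
  id-LocLip .on R = R , 1ℚ , λ x y ∣x∣≤R _ → ∣x∣≤R , ℚ.≤-reflexive (sym (ℚ.*-identityˡ ∣ x - y ∣))

  +-LocLip : ∀ {f g} → LocLip f → LocLip g → LocLip (λ x → f x + g x)
  +-LocLip {f} {g} fL gL .on R =
    let (B₁ , C₁ , h₁) = fL .on R
        (B₂ , C₂ , h₂) = gL .on R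
    in B₁ + B₂ , C₁ + C₂ , λ x y ∣x∣≤R ∣y∣≤R →
    let (f≤ , fΔ) = h₁ x y ∣x∣≤R ∣y∣≤R
        (g≤ , gΔ) = h₂ x y ∣x∣≤R ∣y∣≤R
    in ℚ.≤-trans (ℚ.∣p+q∣≤∣p∣+∣q∣ (f x) (g x)) (ℚ.+-mono-≤ f≤ g≤) , (begin
    ∣ (f x + g x) - (f y + g y) ∣
      ≡⟨ cong ∣_∣ (solve 4 (λ a b c d → (a :+ b) :- (c :+ d) :=
           (a :- c) :+ (b :- d)) refl (f x) (g x) (f y) (g y)) ⟩
    ∣ (f x - f y) + (g x - g y) ∣
      ≤⟨ ℚ.∣p+q∣≤∣p∣+∣q∣ (f x - f y) (g x - g y) ⟩
    ∣ f x - f y ∣ + ∣ g x - g y ∣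
      ≤⟨ ℚ.+-mono-≤ fΔ gΔ ⟩
    C₁ * ∣ x - y ∣ + C₂ * ∣ x - y ∣
      ≡⟨ ℚ.*-distribʳ-+ ∣ x - y ∣ C₁ C₂ ⟨
    (C₁ + C₂) * ∣ x - y ∣ ∎)

  *-LocLip : ∀ {f g} → LocLip f → LocLip g → LocLip (λ x → f x * g x)
  *-LocLip {f} {g} fL gL .on R =
    let (B₁ , C₁ , h₁) = fL .on R
        (B₂ , C₂ , h₂) = gL .on R
    in B₁ * B₂ , B₁ * C₂ + C₁ * B₂ , λ x y ∣x∣≤R ∣y∣≤R →
    let (f≤ , fΔ) = h₁ x y ∣x∣≤R ∣y∣≤R
        (g≤ , gΔ) = h₂ x y ∣x∣≤R ∣y∣≤R
        -- The boundedness clause concerns the first argument only, so the bound at `y` comes from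
        -- exchanging the two points.
        (g≤′ , _) = h₂ y x ∣y∣≤R ∣x∣≤R
    in (begin
    ∣ f x * g x ∣       ≡⟨ ℚ.∣p*q∣≡∣p∣*∣q∣ (f x) (g x) ⟩
    ∣ f x ∣ * ∣ g x ∣   ≤⟨ *-mono-≤ (ℚ.0≤∣p∣ (f x)) f≤ (ℚ.0≤∣p∣ (g x)) g≤ ⟩
    B₁ * B₂             ∎) , (begin
    ∣ f x * g x - f y * g y ∣
      ≡⟨ cong ∣_∣ (solve 4 (λ a b c d → a :* b :- c :* d :=
           a :* (b :- d) :+ (a :- c) :* d) refl (f x) (g x) (f y) (g y)) ⟩
    ∣ f x * (g x - g y) + (f x - f y) * g y ∣
      ≤⟨ ℚ.∣p+q∣≤∣p∣+∣q∣ (f x * (g x - g y)) ((f x - f y) * g y) ⟩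
    ∣ f x * (g x - g y) ∣ + ∣ (f x - f y) * g y ∣
      ≡⟨ cong₂ _+_ (ℚ.∣p*q∣≡∣p∣*∣q∣ (f x) (g x - g y)) (ℚ.∣p*q∣≡∣p∣*∣q∣ (f x - f y) (g y)) ⟩
    ∣ f x ∣ * ∣ g x - g y ∣ + ∣ f x - f y ∣ * ∣ g y ∣
      ≤⟨ ℚ.+-mono-≤
           (*-mono-≤ (ℚ.0≤∣p∣ (f x)) f≤ (ℚ.0≤∣p∣ (g x - g y)) gΔ)
           (*-mono-≤ (ℚ.0≤∣p∣ (f x - f y)) fΔ (ℚ.0≤∣p∣ (g y)) g≤′) ⟩
    B₁ * (C₂ * ∣ x - y ∣) + (C₁ * ∣ x - y ∣) * B₂
      ≡⟨ solve 5 (λ b₁ c₂ c₁ b₂ d → b₁ :* (c₂ :* d) :+ (c₁ :* d) :* b₂ := (b₁ :* c₂ :+ c₁ :* b₂) :* d)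
           refl B₁ C₂ C₁ B₂ ∣ x - y ∣ ⟩
    (B₁ * C₂ + C₁ * B₂) * ∣ x - y ∣ ∎)

  neg-LocLip : ∀ {f} → LocLip f → LocLip (λ x → - f x)
  neg-LocLip {f} fL .on R =
    let (B , C , h) = fL .on R in B , C , λ x y ∣x∣≤R ∣y∣≤R →
    let (f≤ , fΔ) = h x y ∣x∣≤R ∣y∣≤R in
    ℚ.≤-trans (ℚ.≤-reflexive (ℚ.∣-p∣≡∣p∣ (f x))) f≤ , (begin
    ∣ - f x - - f y ∣    ≡⟨ cong ∣_∣ (ℚ.neg-distrib-+ (f x) (- f y)) ⟨
    ∣ - (f x - f y) ∣    ≡⟨ ℚ.∣-p∣≡∣p∣ (f x - f y) ⟩
    ∣ f x - f y ∣        ≤⟨ fΔ ⟩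
    C * ∣ x - y ∣        ∎)

  at-zero : ∀ {f} → LocLip f →
    ∃[ C ] (∀ η → ∣ η ∣ ≤ 1ℚ → ∣ f η - f 0ℚ ∣ ≤ C * ∣ η ∣)
  at-zero {f} fL = let (_ , C , h) = fL .on 1ℚ in C , λ η ∣η∣≤1 → begin
    ∣ f η - f 0ℚ ∣    ≤⟨ proj₂ (h η 0ℚ ∣η∣≤1 (ℚ.≤ᵇ⇒≤ _)) ⟩
    C * ∣ η - 0ℚ ∣    ≡⟨ cong (λ z → C * ∣ z ∣) (ℚ.+-identityʳ η) ⟩
    C * ∣ η ∣         ∎

  -- The function `q − c p` vanishes at 0, so it is at most `C₁ ∣η∣`, while `∣p η∣` is at least
  -- `∣p 0∣ − C₂ ∣η∣`. The claim therefore holds once `(C₁ + δ C₂) ∣η∣ < δ ∣p 0∣`, and this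
  -- determines `K`.
  quotient-limit : ∀ {p q} → LocLip p → LocLip q → ∀ c →
    q 0ℚ ≡ c * p 0ℚ → p 0ℚ ≢ 0ℚ → ∀ {δ} → 0ℚ < δ →
    ∃[ K ] (∀ η → ∣ η ∣ ≤ 1/[1+ K ] → ∣ q η - c * p η ∣ < δ * ∣ p η ∣)
  quotient-limit {p} {q} pL qL c q₀≡cp₀ p₀≢0 {δ} 0<δ =
    let (C₁ , h₁) = at-zero (+-LocLip qL (neg-LocLip (*-LocLip (const-LocLip c) pL)))
        (C₂ , h₂) = at-zero pL
        (K , small) = archimedean (C₁ + δ * C₂) (*-pos 0<δ (∣-∣-pos p₀≢0))
    in K , λ η ∣η∣≤ →
    let ∣η∣≤1 = ℚ.≤-trans ∣η∣≤ (1/-antimono {0} {K} ℕ.z≤n)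
        T = λ x → q x - c * p x
        T₀≡0 : T 0ℚ ≡ 0ℚ
        T₀≡0 = trans (cong (_- c * p 0ℚ) q₀≡cp₀) (ℚ.+-inverseʳ (c * p 0ℚ))
    in begin-strict
    ∣ T η ∣                    ≡⟨ cong ∣_∣ (trans (cong (λ z → T η - z) T₀≡0) (ℚ.+-identityʳ (T η))) ⟨
    ∣ T η - T 0ℚ ∣             ≤⟨ h₁ η ∣η∣≤1 ⟩
    C₁ * ∣ η ∣
      ≡⟨ solve 4 (λ a d b t → a :* t := (a :+ d :* b) :* t :- d :* (b :* t)) refl C₁ δ C₂ ∣ η ∣ ⟩
    (C₁ + δ * C₂) * ∣ η ∣ - δ * (C₂ * ∣ η ∣)
                               <⟨ ℚ.+-monoˡ-< (- (δ * (C₂ * ∣ η ∣))) (small (ℚ.0≤∣p∣ η) ∣η∣≤) ⟩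
    δ * ∣ p 0ℚ ∣ - δ * (C₂ * ∣ η ∣)
      ≡⟨ solve 3 (λ d x y → d :* x :- d :* y := d :* (x :- y)) refl δ ∣ p 0ℚ ∣ (C₂ * ∣ η ∣) ⟩
    δ * (∣ p 0ℚ ∣ - C₂ * ∣ η ∣)
                               ≤⟨ ℚ.*-monoˡ-≤-nonNeg δ {{nonNegative (ℚ.<⇒≤ 0<δ)}} (≤+⇒-≤ (begin
      ∣ p 0ℚ ∣                        ≡⟨ cong ∣_∣ (solve 2 (λ a b → a := (a :- b) :+ b) refl (p 0ℚ) (p η)) ⟩
      ∣ (p 0ℚ - p η) + p η ∣          ≤⟨ ℚ.∣p+q∣≤∣p∣+∣q∣ (p 0ℚ - p η) (p η) ⟩
      ∣ p 0ℚ - p η ∣ + ∣ p η ∣        ≡⟨ cong (_+ ∣ p η ∣) (∣-∣-sub-comm (p 0ℚ) (p η)) ⟩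
      ∣ p η - p 0ℚ ∣ + ∣ p η ∣        ≤⟨ ℚ.+-monoˡ-≤ ∣ p η ∣ (h₂ η ∣η∣≤1) ⟩
      C₂ * ∣ η ∣ + ∣ p η ∣            ∎)) ⟩
    δ * ∣ p η ∣                ∎

  -- A walk along the grid of step `h` that stops at the first cell whose right end reaches the
  -- level `a`; each test is a decidable comparison of rationals.
  crossing : ∀ (g : ℚ → ℚ) a h n t → 0ℚ ≤ h → g t < a → a ≤ g (t + fromℤ (+ n) * h) →
    ∃[ u ] (t ≤ u × u + h ≤ t + fromℤ (+ n) * h × g u < a × a ≤ g (u + h))
  crossing g a h zero t 0≤h gt<a a≤g = contradiction (ℚ.<-≤-trans gt<a
    (subst (λ z → a ≤ g z) (trans (cong (_+_ t) (ℚ.*-zeroˡ h)) (ℚ.+-identityʳ t)) a≤g)) (ℚ.<-irrefl refl)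
  crossing g a h (suc n) t 0≤h gt<a a≤g with g (t + h) ℚ.<? a
  ... | no gt+h≮a = t , ℚ.≤-refl , (begin
      t + h                              ≡⟨ cong (_+_ t) (ℚ.*-identityˡ h) ⟨
      t + 1ℚ * h                         ≤⟨ ℚ.+-monoʳ-≤ t (ℚ.*-monoʳ-≤-nonNeg h {{nonNegative 0≤h}}
                                              (fromℤ-mono-≤ (ℤ.+≤+ (ℕ.s≤s (ℕ.z≤n {n}))))) ⟩
      t + fromℤ (+ suc n) * h            ∎) , gt<a , ℚ.≮⇒≥ gt+h≮a
  ... | yes gt+h<a =
    let (u , t+h≤u , u+h≤ , gu<a , a≤gu+h) =
          crossing g a h n (t + h) 0≤h gt+h<a (subst (λ z → a ≤ g z) shift a≤g)
    in u , ℚ.≤-trans t≤t+h t+h≤u , ℚ.≤-trans u+h≤ (ℚ.≤-reflexive (sym shift)) , gu<a , a≤gu+h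
    where
    t≤t+h : t ≤ t + h
    t≤t+h = ℚ.≤-trans (ℚ.≤-reflexive (sym (ℚ.+-identityʳ t))) (ℚ.+-monoʳ-≤ t 0≤h)
    shift : t + fromℤ (+ suc n) * h ≡ (t + h) + fromℤ (+ n) * h
    shift = trans (cong (λ z → t + z * h) (fromℤ-+ 1ℤ (+ n)))
      (solve 3 (λ t h k → t :+ (con 1ℚ :+ k) :* h := (t :+ h) :+ k :* h) refl t h (fromℤ (+ n)))

  -- The grid is so fine that the Lipschitz bound keeps the change of `g` over one cell below `δ`.
  -- Taking the right end of the crossing cell makes the approximation one-sided, which later keeps
  -- `P(ρ)` away from 0.
  intermediate-value : ∀ {g} → LocLip g → ∀ {a} → g 0ℚ < a → a ≤ g 1ℚ → ∀ {δ} → 0ℚ < δ →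
    ∃[ s ] (a ≤ g s × g s - a ≤ δ)
  intermediate-value {g} gL {a} g0<a a≤g1 {δ} 0<δ =
    let (_ , C , lip) = gL .on 1ℚ
        (K , small) = archimedean C 0<δ
        h = 1/[1+ K ]
        0≤h = ℚ.<⇒≤ 0<1/[1+ K ]
        end≡1 : 0ℚ + fromℤ (+ suc K) * h ≡ 1ℚ
        end≡1 = trans (ℚ.+-identityˡ _) (fromℤ-1/ K)
        (u , 0≤u , u+h≤ , gu<a , a≤gu+h) =
          crossing g a h (suc K) 0ℚ 0≤h g0<a (subst (λ z → a ≤ g z) (sym end≡1) a≤g1)
        u≤u+h = ℚ.≤-trans (ℚ.≤-reflexive (sym (ℚ.+-identityʳ u))) (ℚ.+-monoʳ-≤ u 0≤h)
        u+h≤1 = ℚ.≤-trans u+h≤ (ℚ.≤-reflexive end≡1)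
        0≤u+h = ℚ.≤-trans 0≤u u≤u+h
    in u + h , a≤gu+h , (begin
    g (u + h) - a           ≤⟨ ℚ.+-monoʳ-≤ (g (u + h)) (ℚ.neg-antimono-≤ (ℚ.<⇒≤ gu<a)) ⟩
    g (u + h) - g u         ≤⟨ p≤∣p∣ _ ⟩
    ∣ g (u + h) - g u ∣     ≤⟨ proj₂ (lip (u + h) u
                                 (ℚ.≤-trans (ℚ.≤-reflexive (ℚ.0≤p⇒∣p∣≡p 0≤u+h)) u+h≤1)
                                 (ℚ.≤-trans (ℚ.≤-reflexive (ℚ.0≤p⇒∣p∣≡p 0≤u)) (ℚ.≤-trans u≤u+h u+h≤1))) ⟩
    C * ∣ (u + h) - u ∣     ≡⟨ cong (λ z → C * ∣ z ∣) (solve 2 (λ u h → (u :+ h) :- u := h) refl u h) ⟩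
    C * ∣ h ∣               ≡⟨ cong (C *_) (ℚ.0≤p⇒∣p∣≡p 0≤h) ⟩
    C * h                   ≤⟨ ℚ.<⇒≤ (small 0≤h ℚ.≤-refl) ⟩
    δ                       ∎)

open LocallyLipschitz

-- Bézout identities and the factorisations of values of `P`.

module Arithmetic where

  open import Data.Integer.Base hiding (suc)
  open ≡-Reasoning
  open ℤ-Solver

  bézout-ℕ : ∀ {m d} → Bézout.Identity 1 m d → ∃[ r ] ∃[ t ] + d * r ≡ 1ℤ + + m * t
  bézout-ℕ {m} {d} (Bézout.+- x y eq) = - + y , - + x , (begin
    + d * - + y             ≡⟨ solve 2 (λ d y → d :* (:- y) := con 1ℤ :- (con 1ℤ :+ y :* d)) refl (+ d) (+ y) ⟩
    1ℤ - (1ℤ + + y * + d)   ≡⟨ cong (λ z → 1ℤ - (1ℤ + z)) (ℤ.pos-* y d) ⟨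
    1ℤ - + (1 ℕ.+ y ℕ.* d)  ≡⟨ cong (λ z → 1ℤ - + z) eq ⟩
    1ℤ - + (x ℕ.* m)        ≡⟨ cong (_-_ 1ℤ) (ℤ.pos-* x m) ⟩
    1ℤ - + x * + m          ≡⟨ solve 2 (λ x m → con 1ℤ :- x :* m := con 1ℤ :+ m :* (:- x)) refl (+ x) (+ m) ⟩
    1ℤ + + m * - + x        ∎)
  bézout-ℕ {m} {d} (Bézout.-+ x y eq) = + y , + x , (begin
    + d * + y               ≡⟨ ℤ.*-comm (+ d) (+ y) ⟩
    + y * + d               ≡⟨ ℤ.pos-* y d ⟨
    + (y ℕ.* d)             ≡⟨ cong +_ eq ⟨
    1ℤ + + (x ℕ.* m)        ≡⟨ cong (_+_ 1ℤ) (trans (ℤ.pos-* x m) (ℤ.*-comm (+ x) (+ m))) ⟩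
    1ℤ + + m * + x          ∎)

  bézout : ∀ ρ → ∃[ r ] ∃[ t ] ℚ.↧ ρ * r ≡ 1ℤ + ℚ.↥ ρ * t
  bézout (mkℚ (+ n) d-1 c) = bézout-ℕ (Coprimality.coprime-Bézout (Coprimality.recompute c))
  bézout (mkℚ -[1+ n ] d-1 c) =
    let (r , t , eq) = bézout-ℕ (Coprimality.coprime-Bézout (Coprimality.recompute c))
    in r , - t , trans eq (cong (_+_ 1ℤ)
         (solve 2 (λ m t → m :* t := (:- m) :* (:- t)) refl (+ suc n) t))

  -- As `v ≥ 1`, the choice `s = ∣x₀∣ + K + 1` gives `x₀ + v s ≥ K + 1`. The form `+ suc k` is
  -- wanted because its reciprocal is `1/[1+ k ]`, at most `1/[1+ K ]`.
  grows : ∀ x₀ v .{{_ : ℕ.NonZero v}} K → ∃[ s ] ∃[ k ] (K ℕ.≤ k × x₀ + + v * s ≡ + suc k)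
  grows x₀ v K = let (k , K≤k , eq) = above lower in + suc (∣ x₀ ∣ ℕ.+ K) , k , K≤k , eq
    where
    0≤x+∣x∣ : ∀ x → 0ℤ ≤ x + + ∣ x ∣
    0≤x+∣x∣ (+ n)    = +≤+ ℕ.z≤n
    0≤x+∣x∣ -[1+ n ] = ℤ.≤-reflexive (sym (ℤ.+-inverseˡ (+ suc n)))
    above : ∀ {z} → + suc K ≤ z → ∃[ k ] (K ℕ.≤ k × z ≡ + suc k)
    above (+≤+ (ℕ.s≤s K≤k)) = _ , K≤k , refl
    lower : + suc K ≤ x₀ + + v * + suc (∣ x₀ ∣ ℕ.+ K)
    lower = ℤ.≤-trans
      (ℤ.≤-trans
        (ℤ.≤-reflexive (sym (ℤ.+-identityˡ (+ suc K))))
        (ℤ.+-monoˡ-≤ (+ suc K) (0≤x+∣x∣ x₀)))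
      (ℤ.≤-trans
        (ℤ.≤-reflexive (trans (ℤ.+-assoc x₀ (+ ∣ x₀ ∣) (+ suc K))
          (cong (λ z → x₀ + + z) (ℕ.+-suc ∣ x₀ ∣ K))))
        (ℤ.+-monoʳ-≤ x₀ (ℤ.≤-trans (+≤+ (ℕ.m≤n*m (suc (∣ x₀ ∣ ℕ.+ K)) v)) (ℤ.≤-reflexive (ℤ.pos-* v _)))))

  -- If P(θ) = 0, then (x − y θ)(e + a m + m θ) = n − θ under the hypothesis;
  -- this is the corresponding identity of norms.  The multiplier K below is the
  -- quotient of the difference of both sides by the hypothesis.
  root-product₂ : ∀ {a b x y e m} → y * e ≡ 1ℤ + m * x →
    let n = x * e + a * (m * x) + b * (m * y) in
    n * n + a * n + b ≡
    (e * e + a * (e * m) + b * (m * m)) * (x * x + a * (x * y) + b * (y * y))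
  root-product₂ {a} {b} {x} {y} {e} {m} eq = begin
    n * n + a * n + b   ≡⟨ solve 6 (λ a b x y e m →
       let n = x :* e :+ a :* (m :* x) :+ b :* (m :* y) in
       n :* n :+ a :* n :+ b :=
       (e :* e :+ a :* (e :* m) :+ b :* (m :* m)) :* (x :* x :+ a :* (x :* y) :+ b :* (y :* y))
       :+ (y :* e :- (con 1ℤ :+ m :* x)) :*
          (b :* (m :* x) :- (x :* e :* a :+ x :* a :* a :* m :+ y :* e :* b :+ y :* a :* b :* m :+ b)))
       refl a b x y e m ⟩
    F + (y * e - (1ℤ + m * x)) * K ≡⟨ cong (λ z → F + (z - (1ℤ + m * x)) * K) eq ⟩
    F + (1ℤ + m * x - (1ℤ + m * x)) * K ≡⟨ cong (λ z → F + z * K) (ℤ.+-inverseʳ (1ℤ + m * x)) ⟩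
    F + 0ℤ ≡⟨ ℤ.+-identityʳ F ⟩
    F ∎
    where
    n = x * e + a * (m * x) + b * (m * y)
    F = (e * e + a * (e * m) + b * (m * m)) * (x * x + a * (x * y) + b * (y * y))
    K = b * (m * x) - (x * e * a + x * a * a * m + y * e * b + y * a * b * m + b)

  -- By the hypothesis, n = (x − F(x, y)) / y, so x − y n = F(x, y); the other factor
  -- is P(n) / F(x, y), the division by y³ having been carried out using x² = 1 + y e.
  root-product₃ : ∀ {a b c x y e} → x * x ≡ 1ℤ + y * e →
    let h = a * e + b * x + c * y
        n = - (x * e + a + y * h)
    in n * n * n + a * (n * n) + b * n + c ≡
       (b * e + c * x - a * h - (e * e * e + (x * e * h + x * e * h) + y * (h * h))) * (x - y * n)
  root-product₃ {a} {b} {c} {x} {y} {e} eq = begin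
    n * n * n + a * (n * n) + b * n + c   ≡⟨ solve 6 (λ a b c x y e →
       let h = a :* e :+ b :* x :+ c :* y
           n = :- (x :* e :+ a :+ y :* h)
       in n :* n :* n :+ a :* (n :* n) :+ b :* n :+ c :=
       (b :* e :+ c :* x :- a :* h :- (e :* e :* e :+ (x :* e :* h :+ x :* e :* h) :+ y :* (h :* h))) :* (x :- y :* n)
       :+ (x :* x :- (con 1ℤ :+ y :* e)) :*
          ((b :- e :* e) :* (x :* y :* b :+ x :* e :+ y :* y :* c :+ y :* e :* a)
           :+ x :* e :* b :+ y :* e :* c :+ a :* b :- c))
       refl a b c x y e ⟩
    F + (x * x - (1ℤ + y * e)) * K ≡⟨ cong (λ z → F + (z - (1ℤ + y * e)) * K) eq ⟩
    F + (1ℤ + y * e - (1ℤ + y * e)) * K ≡⟨ cong (λ z → F + z * K) (ℤ.+-inverseʳ (1ℤ + y * e)) ⟩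
    F + 0ℤ ≡⟨ ℤ.+-identityʳ F ⟩
    F ∎
    where
    h = a * e + b * x + c * y
    n = - (x * e + a + y * h)
    F = (b * e + c * x - a * h - (e * e * e + (x * e * h + x * e * h) + y * (h * h))) * (x - y * n)
    K = (b - e * e) * (x * y * b + x * e + y * y * c + y * e * a) + x * e * b + y * e * c + a * b - c

  bézout-shift : ∀ {v r j t} s → v * r ≡ 1ℤ + j * t → v * (r + j * s) ≡ 1ℤ + j * (t + v * s)
  bézout-shift {v} {r} {j} {t} s eq = begin
    v * (r + j * s)               ≡⟨ ℤ.*-distribˡ-+ v r (j * s) ⟩
    v * r + v * (j * s)           ≡⟨ cong (_+ v * (j * s)) eq ⟩
    1ℤ + j * t + v * (j * s)
      ≡⟨ solve 4 (λ v j t s → con 1ℤ :+ j :* t :+ v :* (j :* s) := con 1ℤ :+ j :* (t :+ v :* s)) refl v j t s ⟩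
    1ℤ + j * (t + v * s)          ∎

  -- Here `x − 1 = 2 j u` and `x + 1 = 2 (1 + j u) = 2 v w`, so the modulus `2 u v` takes `u` from
  -- one factor and `v` from the other. The 2 in `x` is what makes `x + 1` a multiple of `1 + j u`.
  square-root-of-1 : ∀ {v w j u} → v * w ≡ 1ℤ + j * u →
    let x = 1ℤ + + 2 * (j * u) in x * x ≡ 1ℤ + (v * + 2 * u) * (+ 2 * (j * w))
  square-root-of-1 {v} {w} {j} {u} eq = begin
    x * x
      ≡⟨ solve 2 (λ j u → let x = con 1ℤ :+ con (+ 2) :* (j :* u) in
           x :* x := con 1ℤ :+ con (+ 2) :* u :* (con (+ 2) :* j) :* (con 1ℤ :+ j :* u)) refl j u ⟩
    1ℤ + + 2 * u * (+ 2 * j) * (1ℤ + j * u)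
      ≡⟨ cong (λ z → 1ℤ + + 2 * u * (+ 2 * j) * z) eq ⟨
    1ℤ + + 2 * u * (+ 2 * j) * (v * w)
      ≡⟨ solve 4 (λ v w j u → con 1ℤ :+ con (+ 2) :* u :* (con (+ 2) :* j) :* (v :* w) :=
           con 1ℤ :+ (v :* con (+ 2) :* u) :* (con (+ 2) :* (j :* w))) refl v w j u ⟩
    1ℤ + (v * + 2 * u) * (+ 2 * (j * w)) ∎
    where x = 1ℤ + + 2 * (j * u)

open Arithmetic

-- Ratios approximable by factorisations of polynomial values.

module Splitting where

  open import Data.Rational.Base
  open ℚ.≤-Reasoning
  open +-*-Solver

  -- Closeness of `d₁ / d₂` to `c` with the denominator cleared: no division occurs, and strictness
  -- forces `d₂` to be nonzero.
  Splits : (ℤ → ℤ) → ℚ → Set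
  Splits f c = ∀ δ → 0ℚ < δ → ∃[ n ] ∃[ d₁ ] ∃[ d₂ ]
    (f n ≡ d₁ ℤ.* d₂ × ∣ fromℤ d₁ - c * fromℤ d₂ ∣ < δ * ∣ fromℤ d₂ ∣)

  -- The approximable ratios form a closed set, so the equations `ρ² = t` and `−P(ρ) = t` need only
  -- approximate rational solutions.
  Splits-closed : ∀ {f c} → (∀ {δ} → 0ℚ < δ → ∃[ c′ ] (∣ c′ - c ∣ ≤ δ × Splits f c′)) → Splits f c
  Splits-closed {f} {c} near δ 0<δ =
    let (c′ , c′≈c , splits) = near (half-pos 0<δ)
        (n , d₁ , d₂ , fn≡ , ratio) = splits (½ * δ) (half-pos 0<δ)
        D₁ = fromℤ d₁
        D₂ = fromℤ d₂
    in n , d₁ , d₂ , fn≡ , (begin-strict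
    ∣ D₁ - c * D₂ ∣                            ≤⟨ ∣-∣-triangle D₁ (c′ * D₂) (c * D₂) ⟩
    ∣ D₁ - c′ * D₂ ∣ + ∣ c′ * D₂ - c * D₂ ∣    ≡⟨ cong (λ z → ∣ D₁ - c′ * D₂ ∣ + ∣ z ∣)
                                                   (solve 3 (λ p q d → p :* d :- q :* d :=
                                                        (p :- q) :* d) refl c′ c D₂) ⟩
    ∣ D₁ - c′ * D₂ ∣ + ∣ (c′ - c) * D₂ ∣       ≡⟨ cong (_+_ ∣ D₁ - c′ * D₂ ∣) (ℚ.∣p*q∣≡∣p∣*∣q∣ (c′ - c) D₂) ⟩
    ∣ D₁ - c′ * D₂ ∣ + ∣ c′ - c ∣ * ∣ D₂ ∣     <⟨ ℚ.+-mono-<-≤ ratio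
                                                   (ℚ.*-monoʳ-≤-nonNeg ∣ D₂ ∣ {{ℚ.∣-∣-nonNeg D₂}} c′≈c) ⟩
    ½ * δ * ∣ D₂ ∣ + ½ * δ * ∣ D₂ ∣            ≡⟨ ℚ.*-distribʳ-+ ∣ D₂ ∣ (½ * δ) (½ * δ) ⟨
    (½ * δ + ½ * δ) * ∣ D₂ ∣                   ≡⟨ cong (_* ∣ D₂ ∣) (halves δ) ⟨
    δ * ∣ D₂ ∣                                 ∎)

  -- The condition is homogeneous in the pair of factors, so the power of `x` or `y` extracted from
  -- both of them drops out.
  rescale : ∀ X {d₁ d₂} p q c δ → X ≢ 0ℚ → d₁ ≡ X * q → d₂ ≡ X * p →
    ∣ q - c * p ∣ < δ * ∣ p ∣ → ∣ d₁ - c * d₂ ∣ < δ * ∣ d₂ ∣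
  rescale X p q c δ X≢0 refl refl close = begin-strict
    ∣ X * q - c * (X * p) ∣
      ≡⟨ cong ∣_∣ (solve 4 (λ x q c p → x :* q :- c :* (x :* p) := x :* (q :- c :* p)) refl X q c p) ⟩
    ∣ X * (q - c * p) ∣       ≡⟨ ℚ.∣p*q∣≡∣p∣*∣q∣ X (q - c * p) ⟩
    ∣ X ∣ * ∣ q - c * p ∣     <⟨ ℚ.*-monoʳ-<-pos ∣ X ∣ {{positive (∣-∣-pos X≢0)}} close ⟩
    ∣ X ∣ * (δ * ∣ p ∣)       ≡⟨ solve 3 (λ x d p → x :* (d :* p) := d :* (x :* p)) refl (∣ X ∣) δ (∣ p ∣) ⟩
    δ * (∣ X ∣ * ∣ p ∣)       ≡⟨ cong (δ *_) (ℚ.∣p*q∣≡∣p∣*∣q∣ X p) ⟨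
    δ * ∣ X * p ∣             ∎

  invertible⇒≢0 : ∀ p q → p * q ≡ 1ℚ → p ≢ 0ℚ
  invertible⇒≢0 p q pq≡1 refl = ℚ.1≢0 (trans (sym pq≡1) (ℚ.*-zeroˡ q))

  ∣1/∣≤ : ∀ {K k} → K ℕ.≤ k → ∣ 1/[1+ k ] ∣ ≤ 1/[1+ K ]
  ∣1/∣≤ {_} {k} K≤k = ℚ.≤-trans (ℚ.≤-reflexive (ℚ.0≤p⇒∣p∣≡p (ℚ.<⇒≤ 0<1/[1+ k ]))) (1/-antimono K≤k)

  infix 4 _↦_
  infixl 6 _⊕_ _⊝_
  infixl 7 _⊗_

  -- Wrapped in a record so that both indices are inferred.
  record _↦_ (i : ℤ) (p : ℚ) : Set where
    constructor image
    field fromℤ≡ : fromℤ i ≡ p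

  open _↦_

  ↦-resp : ∀ {i p q} → i ↦ p → p ≡ q → i ↦ q
  ↦-resp (image i↦p) p≡q = image (trans i↦p p≡q)

  _⊕_ : ∀ {i j p q} → i ↦ p → j ↦ q → i ℤ.+ j ↦ p + q
  _⊕_ {i} {j} (image i↦p) (image j↦q) = image (trans (fromℤ-+ i j) (cong₂ _+_ i↦p j↦q))

  _⊗_ : ∀ {i j p q} → i ↦ p → j ↦ q → i ℤ.* j ↦ p * q
  _⊗_ {i} {j} (image i↦p) (image j↦q) = image (trans (fromℤ-* i j) (cong₂ _*_ i↦p j↦q))

  ⊖_ : ∀ {i p} → i ↦ p → ℤ.- i ↦ - p
  ⊖_ {i} (image i↦p) = image (trans (fromℤ-neg i) (cong -_ i↦p))

  _⊝_ : ∀ {i j p q} → i ↦ p → j ↦ q → i ℤ.- j ↦ p - q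
  i↦p ⊝ j↦q = i↦p ⊕ (⊖ j↦q)

  monic₂ : (a b n : ℤ) → ℤ
  monic₂ a b n = n ℤ.* n ℤ.+ a ℤ.* n ℤ.+ b

  monic₃ : (a b c n : ℤ) → ℤ
  monic₃ a b c n = n ℤ.* n ℤ.* n ℤ.+ a ℤ.* (n ℤ.* n) ℤ.+ b ℤ.* n ℤ.+ c

  monic₃ᵠ : (a b c p : ℚ) → ℚ
  monic₃ᵠ a b c p = p * p * p + a * (p * p) + b * p + c

  -- The quadratic case: factorisations with ratio tending to `ρ²`.

  module Quadratic
    {a b m y : ℤ} {A B M Y ρ w : ℚ}
    (a↦ : a ↦ A) (b↦ : b ↦ B) (m↦ : m ↦ M) (y↦ : y ↦ Y)
    (Yρ≡M : Y * ρ ≡ M) (Yw≡1 : Y * w ≡ 1ℚ) where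

    form : ℚ → ℚ → ℚ
    form u z = u * u + A * (u * z) + B * (z * z)

    -- With `η = 1 / x` these are `d₂ / x²` and `d₁ / x²`: one has `y / x = Y η`, `m / x = M η`, and
    -- `y e = 1 + m x` gives `e / x = ρ + η w`, where `ρ = m / y` and `w = 1 / y`.
    p q : ℚ → ℚ
    p η = form 1ℚ (Y * η)
    q η = form (ρ + η * w) (M * η)

    form-LocLip : ∀ {u z} → LocLip u → LocLip z → LocLip (λ η → form (u η) (z η))
    form-LocLip uL zL = +-LocLip (+-LocLip (*-LocLip uL uL)
      (*-LocLip (const-LocLip A) (*-LocLip uL zL))) (*-LocLip (const-LocLip B) (*-LocLip zL zL))

    p-LocLip : LocLip p
    p-LocLip = form-LocLip {λ _ → 1ℚ} {λ η → Y * η} (const-LocLip 1ℚ) (*-LocLip (const-LocLip Y) id-LocLip)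

    q-LocLip : LocLip q
    q-LocLip = form-LocLip {λ η → ρ + η * w} {λ η → M * η}
      (+-LocLip (const-LocLip ρ) (*-LocLip id-LocLip (const-LocLip w)))
      (*-LocLip (const-LocLip M) id-LocLip)

    p₀≡1 : p 0ℚ ≡ 1ℚ
    p₀≡1 = solve 3 (λ A B Y → con 1ℚ :* con 1ℚ :+ A :* (con 1ℚ :* (Y :* con 0ℚ)) :+ B :* ((Y :* con 0ℚ) :* (Y :* con 0ℚ)) :=
         con 1ℚ) refl A B Y

    p₀≢0 : p 0ℚ ≢ 0ℚ
    p₀≢0 p₀≡0 = ℚ.1≢0 (trans (sym p₀≡1) p₀≡0)

    q₀≡ρ²p₀ : q 0ℚ ≡ ρ * ρ * p 0ℚ
    q₀≡ρ²p₀ = trans (solve 5 (λ A B ρ w M → let u = ρ :+ con 0ℚ :* w ; z = M :* con 0ℚ in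
        u :* u :+ A :* (u :* z) :+ B :* (z :* z) := ρ :* ρ :* con 1ℚ) refl A B ρ w M)
      (cong (ρ * ρ *_) (sym p₀≡1))

    -- As η = 1 / X, each of x, e, m, y is X times a polynomial in η.
    module At {x e X η} (x↦ : x ↦ X) (Xη≡1 : X * η ≡ 1ℚ) (ye≡1+mx : y ℤ.* e ≡ 1ℤ ℤ.+ m ℤ.* x) where

      homogenise : ∀ c → c ≡ X * (c * η)
      homogenise c = sym (trans (solve 3 (λ X c η → X :* (c :* η) := (X :* η) :* c) refl X c η)
        (trans (cong (_* c) Xη≡1) (ℚ.*-identityˡ c)))

      YE≡ : Y * fromℤ e ≡ 1ℚ + M * X
      YE≡ = trans (sym (fromℤ≡ (y↦ ⊗ image {e} refl)))
        (trans (cong fromℤ ye≡1+mx) (fromℤ≡ (image {1ℤ} refl ⊕ m↦ ⊗ x↦)))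

      e↦ : e ↦ X * (ρ + η * w)
      e↦ = image (lemma (fromℤ e) YE≡)
        where
        lemma : ∀ E → Y * E ≡ 1ℚ + M * X → E ≡ X * (ρ + η * w)
        lemma E YE≡ = begin-equality
          E                            ≡⟨ trans (cong (_* E) Yw≡1) (ℚ.*-identityˡ E) ⟨
          Y * w * E                    ≡⟨ solve 3 (λ Y w E → Y :* w :* E := Y :* E :* w) refl Y w E ⟩
          Y * E * w                    ≡⟨ cong (_* w) YE≡ ⟩
          (1ℚ + M * X) * w             ≡⟨ cong₂ (λ z M → (z + M * X) * w) (sym Xη≡1) (sym Yρ≡M) ⟩
          (X * η + Y * ρ * X) * w
            ≡⟨ solve 5 (λ X η Y ρ w → (X :* η :+ Y :* ρ :* X) :* w :=
                 X :* (Y :* w :* ρ :+ η :* w)) refl X η Y ρ w ⟩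
          X * (Y * w * ρ + η * w)      ≡⟨ cong (λ z → X * (z * ρ + η * w)) Yw≡1 ⟩
          X * (1ℚ * ρ + η * w)         ≡⟨ cong (λ z → X * (z + η * w)) (ℚ.*-identityˡ ρ) ⟩
          X * (ρ + η * w)              ∎

      value : ∀ {i j u z} → i ↦ X * u → j ↦ X * z →
        i ℤ.* i ℤ.+ a ℤ.* (i ℤ.* j) ℤ.+ b ℤ.* (j ℤ.* j) ↦ X * X * form u z
      value {u = u} {z} i↦ j↦ = ↦-resp
        (i↦ ⊗ i↦ ⊕ a↦ ⊗ (i↦ ⊗ j↦) ⊕ b↦ ⊗ (j↦ ⊗ j↦))
        (solve 5 (λ X A B u z →
          (X :* u) :* (X :* u) :+ A :* ((X :* u) :* (X :* z)) :+ B :* ((X :* z) :* (X :* z)) :=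
          X :* X :* (u :* u :+ A :* (u :* z) :+ B :* (z :* z))) refl X A B u z)

      numerator : e ℤ.* e ℤ.+ a ℤ.* (e ℤ.* m) ℤ.+ b ℤ.* (m ℤ.* m) ↦ X * X * q η
      numerator = value e↦ (↦-resp m↦ (homogenise M))

      denominator : x ℤ.* x ℤ.+ a ℤ.* (x ℤ.* y) ℤ.+ b ℤ.* (y ℤ.* y) ↦ X * X * p η
      denominator = value (↦-resp x↦ (sym (ℚ.*-identityʳ X))) (↦-resp y↦ (homogenise Y))

      X²≢0 : X * X ≢ 0ℚ
      X²≢0 = invertible⇒≢0 (X * X) (η * η) (trans
        (solve 2 (λ X η → X :* X :* (η :* η) := X :* η :* (X :* η)) refl X η) (cong₂ _*_ Xη≡1 Xη≡1))

      d₁ = e ℤ.* e ℤ.+ a ℤ.* (e ℤ.* m) ℤ.+ b ℤ.* (m ℤ.* m)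
      d₂ = x ℤ.* x ℤ.+ a ℤ.* (x ℤ.* y) ℤ.+ b ℤ.* (y ℤ.* y)

      ratio : ∀ c δ → ∣ q η - c * p η ∣ < δ * ∣ p η ∣ → ∃[ n ] ∃[ d₁ ] ∃[ d₂ ]
        (monic₂ a b n ≡ d₁ ℤ.* d₂ × ∣ fromℤ d₁ - c * fromℤ d₂ ∣ < δ * ∣ fromℤ d₂ ∣)
      ratio c δ close = x ℤ.* e ℤ.+ a ℤ.* (m ℤ.* x) ℤ.+ b ℤ.* (m ℤ.* y) , d₁ , d₂ ,
        root-product₂ {a} {b} {x} {y} {e} {m} ye≡1+mx ,
        rescale (X * X) (p η) (q η) c δ X²≢0 (fromℤ≡ numerator) (fromℤ≡ denominator) close

    splits : ∀ {r t d} → y ≡ + suc d → y ℤ.* r ≡ 1ℤ ℤ.+ m ℤ.* t → Splits (monic₂ a b) (ρ * ρ)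
    splits {r} {t} {d} refl eq δ 0<δ =
      let (K , close) = quotient-limit p-LocLip q-LocLip (ρ * ρ) q₀≡ρ²p₀ p₀≢0 0<δ
          -- Any `x` in the residue class of `t` modulo `y` has a matching `e`, so `x` can be taken
          -- large enough that `1 / x ≤ 1/[1+ K ]`.
          (s , k , K≤k , x≡k) = grows t (suc d) K
      in At.ratio (image (cong fromℤ x≡k)) (fromℤ-1/ k) (bézout-shift {y} {r} {m} {t} s eq)
           (ρ * ρ) δ (close 1/[1+ k ] (∣1/∣≤ K≤k))

  monic₂-splits-at-square : ∀ a b ρ → Splits (monic₂ a b) (ρ * ρ)
  monic₂-splits-at-square a b ρ = let (r , t , eq) = bézout ρ in
    Quadratic.splits {m = ℚ.↥ ρ} {ℚ.↧ ρ} {ρ = ρ} {1/[1+ ℚ.denominator-1 ρ ]}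
      (image {a} refl) (image {b} refl) (image refl) (image refl)
      (denominator-clears ρ) (fromℤ-1/ (ℚ.denominator-1 ρ)) {r} {t} {ℚ.denominator-1 ρ} refl eq

  -- The summands become `1 = Y η` and `2 j u = 2 v ρ u = Y ρ`.
  1+2ju↦ : ∀ ρ {v j u V M U Y η} → v ↦ V → j ↦ M → u ↦ U → V * ρ ≡ M →
    v ℤ.* + 2 ℤ.* u ↦ Y → Y * η ≡ 1ℚ → 1ℤ ℤ.+ + 2 ℤ.* (j ℤ.* u) ↦ Y * (ρ + η)
  1+2ju↦ ρ {V = V} {M} {U} {Y} {η} v↦ j↦ u↦ Vρ≡M y↦ Yη≡1 =
    ↦-resp (image {1ℤ} refl ⊕ two ⊗ (j↦ ⊗ u↦))
      (lemma (fromℤ (+ 2)) (trans (sym (fromℤ≡ (v↦ ⊗ two ⊗ u↦))) (fromℤ≡ y↦)))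
    where
    two = image {+ 2} refl
    lemma : ∀ T → V * T * U ≡ Y → 1ℚ + T * (M * U) ≡ Y * (ρ + η)
    lemma T VTU≡Y = begin-equality
      1ℚ + T * (M * U)          ≡⟨ cong₂ (λ o M → o + T * (M * U)) (sym Yη≡1) (sym Vρ≡M) ⟩
      Y * η + T * (V * ρ * U)
        ≡⟨ cong (_+_ (Y * η)) (solve 4 (λ T V ρ U → T :* (V :* ρ :* U) := V :* T :* U :* ρ) refl T V ρ U) ⟩
      Y * η + V * T * U * ρ     ≡⟨ cong (λ z → Y * η + z * ρ) VTU≡Y ⟩
      Y * η + Y * ρ             ≡⟨ solve 3 (λ Y η ρ → Y :* η :+ Y :* ρ := Y :* (ρ :+ η)) refl Y η ρ ⟩
      Y * (ρ + η)               ∎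

  -- The cubic case: factorisations with ratio tending to `−P(ρ)`.

  module Cubic {a b c : ℤ} {A B C : ℚ} (a↦ : a ↦ A) (b↦ : b ↦ B) (c↦ : c ↦ C) (ρ : ℚ) where

    -- With η = 1 / y: ξ = x / y, ε = e / y, H = h / y, p = d₂ / y³, q = d₁ / y³.
    ξ ε H p q : ℚ → ℚ
    ξ η = ρ + η
    ε η = ξ η * ξ η - η * η
    H η = A * ε η + B * ξ η + C * 1ℚ
    p η = ξ η * (η * η) + (ξ η * ε η + A * (η * η) + H η)
    q η = (B * ε η + C * ξ η - A * H η) * (η * η)
        - (ε η * ε η * ε η + (ξ η * ε η * H η + ξ η * ε η * H η) + H η * H η)

    ξ-LocLip : LocLip ξ
    ξ-LocLip = +-LocLip (const-LocLip ρ) id-LocLip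

    square-LocLip : LocLip (λ η → η * η)
    square-LocLip = *-LocLip id-LocLip id-LocLip

    ε-LocLip : LocLip ε
    ε-LocLip = +-LocLip (*-LocLip ξ-LocLip ξ-LocLip) (neg-LocLip square-LocLip)

    H-LocLip : LocLip H
    H-LocLip = +-LocLip (+-LocLip (*-LocLip (const-LocLip A) ε-LocLip)
      (*-LocLip (const-LocLip B) ξ-LocLip)) (const-LocLip (C * 1ℚ))

    p-LocLip : LocLip p
    p-LocLip = +-LocLip (*-LocLip ξ-LocLip square-LocLip)
      (+-LocLip (+-LocLip (*-LocLip ξ-LocLip ε-LocLip) (*-LocLip (const-LocLip A) square-LocLip)) H-LocLip)

    q-LocLip : LocLip q
    q-LocLip = +-LocLip
      (*-LocLip (+-LocLip (+-LocLip (*-LocLip (const-LocLip B) ε-LocLip) (*-LocLip (const-LocLip C) ξ-LocLip))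
        (neg-LocLip (*-LocLip (const-LocLip A) H-LocLip))) square-LocLip)
      (neg-LocLip (+-LocLip (+-LocLip (*-LocLip (*-LocLip ε-LocLip ε-LocLip) ε-LocLip) (+-LocLip ξεH ξεH))
        (*-LocLip H-LocLip H-LocLip)))
      where
      ξεH : LocLip (λ η → ξ η * ε η * H η)
      ξεH = *-LocLip (*-LocLip ξ-LocLip ε-LocLip) H-LocLip

    p₀≡ : p 0ℚ ≡ monic₃ᵠ A B C ρ
    p₀≡ = solve 4 (λ A B C ρ →
      let z = con 0ℚ ; ξ = ρ :+ z ; ε = ξ :* ξ :- z :* z ; H = A :* ε :+ B :* ξ :+ C :* con 1ℚ in
      ξ :* (z :* z) :+ (ξ :* ε :+ A :* (z :* z) :+ H) :=
      ρ :* ρ :* ρ :+ A :* (ρ :* ρ) :+ B :* ρ :+ C) refl A B C ρ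

    -- At `η = 0` the terms with the factor `η²` vanish and `ε = ρ²`, which leaves a perfect square:
    -- `−(ρ⁶ + 2 ρ³ H + H²) = −(ρ³ + H)²`, with `ρ³ + H = P(ρ)`.
    q₀≡-Pp₀ : q 0ℚ ≡ - monic₃ᵠ A B C ρ * p 0ℚ
    q₀≡-Pp₀ = trans (solve 4 (λ A B C ρ →
      let z = con 0ℚ ; ξ = ρ :+ z ; ε = ξ :* ξ :- z :* z ; H = A :* ε :+ B :* ξ :+ C :* con 1ℚ
          P = ρ :* ρ :* ρ :+ A :* (ρ :* ρ) :+ B :* ρ :+ C in
      (B :* ε :+ C :* ξ :- A :* H) :* (z :* z) :- (ε :* ε :* ε :+ (ξ :* ε :* H :+ ξ :* ε :* H) :+ H :* H) :=
      (:- P) :* P) refl A B C ρ) (cong (- monic₃ᵠ A B C ρ *_) (sym p₀≡))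

    module At {x y e Y η} (x↦ : x ↦ Y * ξ η) (y↦ : y ↦ Y) (Yη≡1 : Y * η ≡ 1ℚ)
      (xx≡1+ye : x ℤ.* x ≡ 1ℤ ℤ.+ y ℤ.* e) where

      Y²η²≡1 : Y * Y * (η * η) ≡ 1ℚ
      Y²η²≡1 = trans
        (solve 2 (λ Y η → Y :* Y :* (η :* η) := Y :* η :* (Y :* η)) refl Y η) (cong₂ _*_ Yη≡1 Yη≡1)

      e↦ : e ↦ Y * ε η
      e↦ = image (lemma (ξ η) (fromℤ e) (trans (sym (fromℤ≡ (x↦ ⊗ x↦)))
             (trans (cong fromℤ xx≡1+ye) (fromℤ≡ (image {1ℤ} refl ⊕ y↦ ⊗ image {e} refl)))))
        where
        lemma : ∀ ξ E → Y * ξ * (Y * ξ) ≡ 1ℚ + Y * E → E ≡ Y * (ξ * ξ - η * η)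
        lemma ξ E X²≡ = begin-equality
          E                                         ≡⟨ trans (cong (_* E) Yη≡1) (ℚ.*-identityˡ E) ⟨
          Y * η * E
            ≡⟨ solve 3 (λ Y η E → Y :* η :* E := η :* ((con 1ℚ :+ Y :* E) :- con 1ℚ)) refl Y η E ⟩
          η * ((1ℚ + Y * E) - 1ℚ)                   ≡⟨ cong₂ (λ z o → η * (z - o)) (sym X²≡) (sym Y²η²≡1) ⟩
          η * (Y * ξ * (Y * ξ) - Y * Y * (η * η))
            ≡⟨ solve 3 (λ Y η ξ → η :* (Y :* ξ :* (Y :* ξ) :- Y :* Y :* (η :* η)) :=
                 (Y :* η) :* (Y :* (ξ :* ξ :- η :* η))) refl Y η ξ ⟩
          Y * η * (Y * (ξ * ξ - η * η))
            ≡⟨ trans (cong (_* (Y * (ξ * ξ - η * η))) Yη≡1) (ℚ.*-identityˡ _) ⟩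
          Y * (ξ * ξ - η * η)                       ∎

      h n d₁ d₂ : ℤ
      h = a ℤ.* e ℤ.+ b ℤ.* x ℤ.+ c ℤ.* y
      n = ℤ.- (x ℤ.* e ℤ.+ a ℤ.+ y ℤ.* h)
      d₁ = b ℤ.* e ℤ.+ c ℤ.* x ℤ.- a ℤ.* h
        ℤ.- (e ℤ.* e ℤ.* e ℤ.+ (x ℤ.* e ℤ.* h ℤ.+ x ℤ.* e ℤ.* h) ℤ.+ y ℤ.* (h ℤ.* h))
      d₂ = x ℤ.- y ℤ.* n

      h↦ : h ↦ Y * H η
      h↦ = ↦-resp (a↦ ⊗ e↦ ⊕ b↦ ⊗ x↦ ⊕ c↦ ⊗ y↦)
        (solve 6 (λ A B C Y ε ξ → A :* (Y :* ε) :+ B :* (Y :* ξ) :+ C :* Y :=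
             Y :* (A :* ε :+ B :* ξ :+ C :* con 1ℚ))
          refl A B C Y (ε η) (ξ η))

      d₁↦ : d₁ ↦ Y * Y * Y * q η
      d₁↦ = ↦-resp
        (b↦ ⊗ e↦ ⊕ c↦ ⊗ x↦ ⊝ a↦ ⊗ h↦ ⊝ (e↦ ⊗ e↦ ⊗ e↦ ⊕ (x↦ ⊗ e↦ ⊗ h↦ ⊕ x↦ ⊗ e↦ ⊗ h↦) ⊕ y↦ ⊗ (h↦ ⊗ h↦)))
        (lemma (ε η) (ξ η) (H η))
        where
        lemma : ∀ ε ξ H →
          B * (Y * ε) + C * (Y * ξ) - A * (Y * H)
            - (Y * ε * (Y * ε) * (Y * ε) + (Y * ξ * (Y * ε) * (Y * H) + Y * ξ * (Y * ε) * (Y * H)) + Y * (Y * H * (Y * H)))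
          ≡ Y * Y * Y * ((B * ε + C * ξ - A * H) * (η * η) - (ε * ε * ε + (ξ * ε * H + ξ * ε * H) + H * H))
        lemma ε ξ H = begin-equality
          _ ≡⟨ solve 7 (λ A B C Y ε ξ H →
                 B :* (Y :* ε) :+ C :* (Y :* ξ) :- A :* (Y :* H)
                   :- (Y :* ε :* (Y :* ε) :* (Y :* ε) :+ (Y :* ξ :* (Y :* ε) :* (Y :* H) :+ Y :* ξ :* (Y :* ε) :* (Y :* H)) :+ Y :* (Y :* H :* (Y :* H)))
                 :=
                      Y :* con 1ℚ :* (B :* ε :+ C :* ξ :- A :* H)
                   :- Y :* Y :* Y :* (ε :* ε :* ε :+ (ξ :* ε :* H :+ ξ :* ε :* H) :+ H :* H))
                 refl A B C Y ε ξ H ⟩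
          -- The factor `1ℚ` left in place by the solver is replaced by `Y² η²`, which raises the
          -- part of degree one to degree three.
          Y * 1ℚ * L - Y * Y * Y * N                ≡⟨ cong (λ z → Y * z * L - Y * Y * Y * N) Y²η²≡1 ⟨
          Y * (Y * Y * (η * η)) * L - Y * Y * Y * N
            ≡⟨ solve 4 (λ Y η L N → Y :* (Y :* Y :* (η :* η)) :* L :- Y :* Y :* Y :* N :=
                 Y :* Y :* Y :* (L :* (η :* η) :- N)) refl Y η L N ⟩
          Y * Y * Y * (L * (η * η) - N)             ∎
          where
          L = B * ε + C * ξ - A * H
          N = ε * ε * ε + (ξ * ε * H + ξ * ε * H) + H * H

      d₂↦ : d₂ ↦ Y * Y * Y * p η
      d₂↦ = ↦-resp (x↦ ⊝ y↦ ⊗ (⊖ (x↦ ⊗ e↦ ⊕ a↦ ⊕ y↦ ⊗ h↦))) (lemma (ε η) (ξ η) (H η))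
        where
        lemma : ∀ ε ξ H → Y * ξ - Y * - (Y * ξ * (Y * ε) + A + Y * (Y * H))
          ≡ Y * Y * Y * (ξ * (η * η) + (ξ * ε + A * (η * η) + H))
        lemma ε ξ H = begin-equality
          Y * ξ - Y * - (Y * ξ * (Y * ε) + A + Y * (Y * H))
            ≡⟨ solve 5 (λ A Y ε ξ H → Y :* ξ :- Y :* (:- (Y :* ξ :* (Y :* ε) :+ A :+ Y :* (Y :* H)))
                 := Y :* con 1ℚ :* (ξ :+ A) :+ Y :* Y :* Y :* (ξ :* ε :+ H)) refl A Y ε ξ H ⟩
          Y * 1ℚ * (ξ + A) + Y * Y * Y * (ξ * ε + H)
            ≡⟨ cong (λ z → Y * z * (ξ + A) + Y * Y * Y * (ξ * ε + H)) Y²η²≡1 ⟨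
          Y * (Y * Y * (η * η)) * (ξ + A) + Y * Y * Y * (ξ * ε + H)
            ≡⟨ solve 6 (λ A Y η ε ξ H → Y :* (Y :* Y :* (η :* η)) :* (ξ :+ A) :+ Y :* Y :* Y :* (ξ :* ε :+ H)
                 := Y :* Y :* Y :* (ξ :* (η :* η) :+ (ξ :* ε :+ A :* (η :* η) :+ H))) refl A Y η ε ξ H ⟩
          Y * Y * Y * (ξ * (η * η) + (ξ * ε + A * (η * η) + H)) ∎

      Y³≢0 : Y * Y * Y ≢ 0ℚ
      Y³≢0 = invertible⇒≢0 (Y * Y * Y) (η * η * η) (trans
        (solve 2 (λ Y η → Y :* Y :* Y :* (η :* η :* η) := Y :* Y :* (η :* η) :* (Y :* η)) refl Y η)
        (cong₂ _*_ Y²η²≡1 Yη≡1))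

      ratio : ∀ k δ → ∣ q η - k * p η ∣ < δ * ∣ p η ∣ → ∃[ n ] ∃[ d₁ ] ∃[ d₂ ]
        (monic₃ a b c n ≡ d₁ ℤ.* d₂ × ∣ fromℤ d₁ - k * fromℤ d₂ ∣ < δ * ∣ fromℤ d₂ ∣)
      ratio k δ close = n , d₁ , d₂ , root-product₃ {a} {b} {c} {x} {y} {e} xx≡1+ye ,
        rescale (Y * Y * Y) (p η) (q η) k δ Y³≢0 (fromℤ≡ d₁↦) (fromℤ≡ d₂↦) close

    splits : ∀ {v r j t d V M} → v ↦ V → j ↦ M → V * ρ ≡ M → v ≡ + suc d → v ℤ.* r ≡ 1ℤ ℤ.+ j ℤ.* t →
      monic₃ᵠ A B C ρ ≢ 0ℚ → Splits (monic₃ a b c) (- monic₃ᵠ A B C ρ)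
    splits {v} {r} {j} {t} {d} v↦ j↦ Vρ≡M refl eq P≢0 δ 0<δ =
      let (K , close) = quotient-limit p-LocLip q-LocLip (- monic₃ᵠ A B C ρ) q₀≡-Pp₀ (P≢0 ∘ trans (sym p₀≡)) 0<δ
          (s , k , K≤k , u≡k) = grows t (suc d) K
      -- With `v = + suc d` and `u = + suc k`, the product `2 u v` reduces to `+ suc l` with `l` of
      -- the form `k + _`, so the lower bound on `k` passes to `l`.
      in result close s (cong (v ℤ.* + 2 ℤ.*_) u≡k) (ℕ.≤-trans K≤k (ℕ.m≤m+n k _))
      where
      result : ∀ {K l} → (∀ η → ∣ η ∣ ≤ 1/[1+ K ] → ∣ q η - - monic₃ᵠ A B C ρ * p η ∣ < δ * ∣ p η ∣) →
        ∀ s → v ℤ.* + 2 ℤ.* (t ℤ.+ v ℤ.* s) ≡ + suc l → K ℕ.≤ l → ∃[ n ] ∃[ d₁ ] ∃[ d₂ ]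
        (monic₃ a b c n ≡ d₁ ℤ.* d₂ × ∣ fromℤ d₁ - - monic₃ᵠ A B C ρ * fromℤ d₂ ∣ < δ * ∣ fromℤ d₂ ∣)
      result {K} {l} close s y≡l K≤l =
        At.ratio (1+2ju↦ ρ v↦ j↦ (image refl) Vρ≡M y↦ (fromℤ-1/ l)) y↦ (fromℤ-1/ l)
          (square-root-of-1 {v} {r ℤ.+ j ℤ.* s} {j} {t ℤ.+ v ℤ.* s} (bézout-shift {v} {r} {j} {t} s eq))
          (- monic₃ᵠ A B C ρ) δ (close 1/[1+ l ] (∣1/∣≤ K≤l))
        where
        y↦ : v ℤ.* + 2 ℤ.* (t ℤ.+ v ℤ.* s) ↦ fromℤ (+ suc l)
        y↦ = image (cong fromℤ y≡l)

  monic₃-splits-at-values : ∀ a b c ρ → monic₃ᵠ (fromℤ a) (fromℤ b) (fromℤ c) ρ ≢ 0ℚ →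
    Splits (monic₃ a b c) (- monic₃ᵠ (fromℤ a) (fromℤ b) (fromℤ c) ρ)
  monic₃-splits-at-values a b c ρ = let (r , t , eq) = bézout ρ in
    Cubic.splits (image {a} refl) (image {b} refl) (image {c} refl) ρ
      {ℚ.↧ ρ} {r} {ℚ.↥ ρ} {t} {ℚ.denominator-1 ρ} (image refl) (image refl) (denominator-clears ρ) refl eq

open Splitting

-- Every positive rational is approximated by the limits `ρ²` and `−P(ρ)`.

module Density where

  open import Data.Rational.Base
  open ℚ.≤-Reasoning
  open +-*-Solver

  monic₃-LocLip : ∀ a b c {f} → LocLip f → LocLip (λ x → monic₃ᵠ a b c (f x))
  monic₃-LocLip a b c fL = +-LocLip (+-LocLip (+-LocLip (*-LocLip (*-LocLip fL fL) fL)
    (*-LocLip (const-LocLip a) (*-LocLip fL fL))) (*-LocLip (const-LocLip b) fL)) (const-LocLip c)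

  absorb : ∀ {a z w} → ∣ a ∣ + z ≤ w → z ≤ w + a
  absorb {a} {z} {w} ∣a∣+z≤w = begin
    z                    ≡⟨ solve 2 (λ a z → z := (a :+ z) :- a) refl ∣ a ∣ z ⟩
    (∣ a ∣ + z) - ∣ a ∣
      ≤⟨ ℚ.+-mono-≤ ∣a∣+z≤w (ℚ.neg-antimono-≤ (ℚ.≤-trans (p≤∣p∣ (- a)) (ℚ.≤-reflexive (ℚ.∣-p∣≡∣p∣ a)))) ⟩
    w - - a              ≡⟨ solve 2 (λ w a → w :- (:- a) := w :+ a) refl w a ⟩
    w + a                ∎

  -- The bound on R is what keeps each Horner step R (… + a) + b above the remaining sum.
  monic₃-large : ∀ a b c {t R} → 0ℚ ≤ t → ∣ a ∣ + (∣ b ∣ + (∣ c ∣ + (1ℚ + t))) ≤ R →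
    1ℚ + t ≤ monic₃ᵠ a b c R
  monic₃-large a b c {t} {R} 0≤t bound = begin
    1ℚ + t                        ≤⟨ step b′ ⟩
    R * (R * (R + a) + b) + c     ≡⟨ solve 4 (λ a b c R → R :* (R :* (R :+ a) :+ b) :+ c :=
                                       R :* R :* R :+ a :* (R :* R) :+ b :* R :+ c) refl a b c R ⟩
    monic₃ᵠ a b c R               ∎
    where
    0≤+ : ∀ p {q} → 0ℚ ≤ q → 0ℚ ≤ ∣ p ∣ + q
    0≤+ p = ℚ.+-mono-≤ (ℚ.0≤∣p∣ p)
    q≤+ : ∀ p {q} → q ≤ ∣ p ∣ + q
    q≤+ p {q} = ℚ.≤-trans (ℚ.≤-reflexive (sym (ℚ.+-identityˡ q))) (ℚ.+-monoˡ-≤ q (ℚ.0≤∣p∣ p))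
    1≤1+t : 1ℚ ≤ 1ℚ + t
    1≤1+t = ℚ.≤-trans (ℚ.≤-reflexive (sym (ℚ.+-identityʳ 1ℚ))) (ℚ.+-monoʳ-≤ 1ℚ 0≤t)
    0≤₀ : 0ℚ ≤ 1ℚ + t
    0≤₀ = ℚ.≤-trans (ℚ.<⇒≤ 0<1/[1+ 0 ]) 1≤1+t
    1≤R : 1ℚ ≤ R
    1≤R = ℚ.≤-trans 1≤1+t (ℚ.≤-trans (q≤+ c) (ℚ.≤-trans (q≤+ b) (ℚ.≤-trans (q≤+ a) bound)))
    step : ∀ {p z w} → 0ℚ ≤ ∣ p ∣ + z × ∣ p ∣ + z ≤ w → z ≤ R * w + p
    step {p} {z} {w} (0≤ , ≤w) = absorb (begin
      ∣ p ∣ + z  ≤⟨ ≤w ⟩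
      w          ≡⟨ ℚ.*-identityˡ w ⟨
      1ℚ * w     ≤⟨ ℚ.*-monoʳ-≤-nonNeg w {{nonNegative (ℚ.≤-trans 0≤ ≤w)}} 1≤R ⟩
      R * w      ∎)
    a′ : 0ℚ ≤ ∣ b ∣ + (∣ c ∣ + (1ℚ + t)) × ∣ b ∣ + (∣ c ∣ + (1ℚ + t)) ≤ R + a
    a′ = 0≤+ b (0≤+ c 0≤₀) , absorb bound
    b′ : 0ℚ ≤ ∣ c ∣ + (1ℚ + t) × ∣ c ∣ + (1ℚ + t) ≤ R * (R + a) + b
    b′ = 0≤+ c 0≤₀ , step a′

  0≤q-p⇒∣q-p∣≤ : ∀ {p q δ} → p ≤ q → q - p ≤ δ → ∣ q - p ∣ ≤ δ
  0≤q-p⇒∣q-p∣≤ p≤q = ℚ.≤-trans (ℚ.≤-reflexive (ℚ.0≤p⇒∣p∣≡p (p≤q⇒0≤q-p p≤q)))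

  monic₂-splits : ∀ a b {t} → 0ℚ < t → Splits (monic₂ a b) t
  monic₂-splits a b {t} 0<t = Splits-closed {monic₂ a b} λ {δ} 0<δ →
    let (s , t≤ , ≤δ) = intermediate-value (*-LocLip ρ-LocLip ρ-LocLip) g₀<t t≤g₁ 0<δ
    in ρ s * ρ s , 0≤q-p⇒∣q-p∣≤ t≤ ≤δ , monic₂-splits-at-square a b (ρ s)
    where
    ρ : ℚ → ℚ
    -- The end point `1 + t` satisfies `(1 + t)² ≥ t` for small and large `t` alike.
    ρ s = s * (1ℚ + t)
    ρ-LocLip : LocLip ρ
    ρ-LocLip = *-LocLip id-LocLip (const-LocLip (1ℚ + t))
    g₀<t : ρ 0ℚ * ρ 0ℚ < t
    g₀<t = ℚ.≤-<-trans (ℚ.≤-reflexive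
      (solve 1 (λ u → con 0ℚ :* u :* (con 0ℚ :* u) := con 0ℚ) refl (1ℚ + t))) 0<t
    0≤1+t²+t : 0ℚ ≤ 1ℚ + t * t + t
    0≤1+t²+t = ℚ.+-mono-≤ (ℚ.+-mono-≤ (ℚ.<⇒≤ 0<1/[1+ 0 ]) (ℚ.<⇒≤ (*-pos 0<t 0<t))) (ℚ.<⇒≤ 0<t)
    t≤g₁ : t ≤ ρ 1ℚ * ρ 1ℚ
    t≤g₁ = begin
      t                           ≡⟨ ℚ.+-identityˡ t ⟨
      0ℚ + t
        ≤⟨ ℚ.+-monoˡ-≤ t 0≤1+t²+t ⟩
      1ℚ + t * t + t + t
        ≡⟨ solve 1 (λ t → con 1ℚ :+ t :* t :+ t :+ t :=
             con 1ℚ :* (con 1ℚ :+ t) :* (con 1ℚ :* (con 1ℚ :+ t))) refl t ⟩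
      ρ 1ℚ * ρ 1ℚ                 ∎

  monic₃-splits : ∀ a b c {t} → 0ℚ < t → Splits (monic₃ a b c) t
  monic₃-splits a b c {t} 0<t = Splits-closed {monic₃ a b c} λ {δ} 0<δ →
    let (s , t≤ , ≤δ) = intermediate-value g-LocLip g₀<t t≤g₁ 0<δ
    in g s , 0≤q-p⇒∣q-p∣≤ t≤ ≤δ , monic₃-splits-at-values a b c (ρ s) (P≢0 s t≤)
    where
    A = fromℤ a
    B = fromℤ b
    C = fromℤ c
    0≤t = ℚ.<⇒≤ 0<t
    R = ∣ A ∣ + (∣ B ∣ + (∣ C ∣ + (1ℚ + t)))
    ρ g : ℚ → ℚ
    -- The path descends from `R` to `−R`, so that `−P(ρ s)` rises from below 0 to above `t` as `s`
    -- goes from 0 to 1.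
    ρ s = R + s * - (R + R)
    g s = - monic₃ᵠ A B C (ρ s)
    P≢0 : ∀ s → t ≤ g s → monic₃ᵠ A B C (ρ s) ≢ 0ℚ
    -- Approximation from above pays off here: `−P(ρ) ≥ t > 0`.
    P≢0 _ t≤ P≡0 = ℚ.<-irrefl refl (ℚ.<-≤-trans 0<t (ℚ.≤-trans t≤ (ℚ.≤-reflexive (cong -_ P≡0))))
    g-LocLip : LocLip g
    g-LocLip = neg-LocLip (monic₃-LocLip A B C
      (+-LocLip (const-LocLip R) (*-LocLip id-LocLip (const-LocLip (- (R + R))))))
    t≤1+t : t ≤ 1ℚ + t
    t≤1+t = ℚ.≤-trans (ℚ.≤-reflexive (sym (ℚ.+-identityˡ t))) (ℚ.+-monoˡ-≤ t (ℚ.<⇒≤ 0<1/[1+ 0 ]))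
    g₀<t : g 0ℚ < t
    g₀<t = ℚ.≤-<-trans (begin
      g 0ℚ
        ≡⟨ cong (λ z → - monic₃ᵠ A B C z) (solve 1 (λ R → R :+ con 0ℚ :* (:- (R :+ R)) := R) refl R) ⟩
      - monic₃ᵠ A B C R
        ≤⟨ ℚ.neg-antimono-≤ (ℚ.≤-trans 0≤t (ℚ.≤-trans t≤1+t (monic₃-large A B C 0≤t ℚ.≤-refl))) ⟩
      - 0ℚ                   ∎) 0<t
    t≤g₁ : t ≤ g 1ℚ
    t≤g₁ = begin
      t                                ≤⟨ t≤1+t ⟩
      -- The value `−P(−R)` is that of the monic cubic with coefficients `−A`, `B`, `−C` at `R`;
      -- these have the same absolute values, so the same `R` serves.
      1ℚ + t                           ≤⟨ monic₃-large (- A) B (- C) 0≤t (ℚ.≤-reflexive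
                                            (cong₂ (λ p q → p + (∣ B ∣ + (q + (1ℚ + t)))) (ℚ.∣-p∣≡∣p∣ A) (ℚ.∣-p∣≡∣p∣ C))) ⟩
      monic₃ᵠ (- A) B (- C) R          ≡⟨ solve 4 (λ A B C R →
                                            R :* R :* R :+ (:- A) :* (R :* R) :+ B :* R :+ (:- C) :=
                                            let x = R :+ con 1ℚ :* (:- (R :+ R)) in
                                            :- (x :* x :* x :+ A :* (x :* x) :+ B :* x :+ C)) refl A B C R ⟩
      g 1ℚ                             ∎

open Density

open import Defs
open import Data.Integer.Base using (ℤ; _*_; NonZero)
open import Data.Nat.Base using (ℕ)
open import Data.Product.Base using (Σ-syntax; ∃-syntax; _×_)
open import Data.Sum.Base using (_⊎_)
open import Relation.Binary.PropositionalEquality using (_≡_)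

-- From coefficient lists to explicit monic quadratics and cubics.

module Coefficients where

  open import Data.Integer.Base hiding (suc; NonZero)
  open ≡-Reasoning

  -- `Monic` carries a degree of its own, which has to be identified with the prescribed 2 or 3.
  degree-unique : ∀ P {d e} → HasDegree P d → HasDegree P e → d ≡ e
  degree-unique P {d} {e} (Pd≢0 , above-d) (Pe≢0 , above-e) with ℕ.<-cmp d e
  ... | tri< d<e _ _ = contradiction (above-d e d<e) Pe≢0
  ... | tri≈ _ d≡e _ = d≡e
  ... | tri> _ _ e<d = contradiction (above-e d e<d) Pd≢0

  leading≡1 : ∀ P {d} → Monic P → HasDegree P d → coeff P d ≡ 1ℤ
  leading≡1 P (e , e-degree , Pe≡1) d-degree =
    trans (cong (coeff P) (degree-unique P d-degree e-degree)) Pe≡1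

  -- This disposes of the trailing zeros that a coefficient list may have beyond its leading term.
  eval-zero : ∀ P → (∀ k → coeff P k ≡ 0ℤ) → ∀ n → eval P n ≡ 0ℤ
  eval-zero []      _    n = refl
  eval-zero (a ∷ P) zero-coeff n = begin
    a + n * eval P n   ≡⟨ cong₂ (λ a v → a + n * v) (zero-coeff 0) (eval-zero P (λ k → zero-coeff (suc k)) n) ⟩
    0ℤ + n * 0ℤ        ≡⟨ trans (ℤ.+-identityˡ (n * 0ℤ)) (ℤ.*-zeroʳ n) ⟩
    0ℤ                 ∎

  monic-quadratic : ∀ P → Monic P → HasDegree P 2 →
    ∃[ a ] ∃[ b ] (∀ n → eval P n ≡ monic₂ a b n)
  monic-quadratic []              _     (P₂≢0 , _) = contradiction refl P₂≢0
  monic-quadratic (_ ∷ [])        _     (P₂≢0 , _) = contradiction refl P₂≢0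
  monic-quadratic (_ ∷ _ ∷ [])    _     (P₂≢0 , _) = contradiction refl P₂≢0
  monic-quadratic P@(b ∷ a ∷ l ∷ Q) monic deg = a , b , λ n → begin
    b + n * (a + n * (l + n * eval Q n))
      ≡⟨ cong₂ (λ l v → b + n * (a + n * (l + n * v))) (leading≡1 P monic deg)
                                               (eval-zero Q (λ k → proj₂ deg (3 ℕ.+ k) (ℕ.s≤s (ℕ.s≤s (ℕ.s≤s ℕ.z≤n)))) n) ⟩
    b + n * (a + n * (1ℤ + n * 0ℤ))       ≡⟨ solve 3 (λ a b n → b :+ n :* (a :+ n :* (con 1ℤ :+ n :* con 0ℤ)) :=
                                               n :* n :+ a :* n :+ b) refl a b n ⟩
    n * n + a * n + b                     ∎
    where open ℤ-Solver

  monic-cubic : ∀ P → Monic P → HasDegree P 3 →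
    ∃[ a ] ∃[ b ] ∃[ c ] (∀ n → eval P n ≡ monic₃ a b c n)
  monic-cubic []                  _ (P₃≢0 , _) = contradiction refl P₃≢0
  monic-cubic (_ ∷ [])            _ (P₃≢0 , _) = contradiction refl P₃≢0
  monic-cubic (_ ∷ _ ∷ [])        _ (P₃≢0 , _) = contradiction refl P₃≢0
  monic-cubic (_ ∷ _ ∷ _ ∷ [])    _ (P₃≢0 , _) = contradiction refl P₃≢0
  monic-cubic P@(c ∷ b ∷ a ∷ l ∷ Q) monic deg = a , b , c , λ n → begin
    c + n * (b + n * (a + n * (l + n * eval Q n)))
      ≡⟨ cong₂ (λ l v → c + n * (b + n * (a + n * (l + n * v)))) (leading≡1 P monic deg)
           (eval-zero Q (λ k → proj₂ deg (4 ℕ.+ k) (ℕ.s≤s (ℕ.s≤s (ℕ.s≤s (ℕ.s≤s ℕ.z≤n))))) n) ⟩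
    c + n * (b + n * (a + n * (1ℤ + n * 0ℤ)))
      ≡⟨ solve 4 (λ a b c n → c :+ n :* (b :+ n :* (a :+ n :* (con 1ℤ :+ n :* con 0ℤ))) :=
           n :* n :* n :+ a :* (n :* n) :+ b :* n :+ c) refl a b c n ⟩
    n * n * n + a * (n * n) + b * n + c ∎
    where open ℤ-Solver

  splits-cong : ∀ {f g} t → (∀ n → f n ≡ g n) → Splits g t → Splits f t
  splits-cong t f≗g splits δ 0<δ =
    let (n , d₁ , d₂ , gn≡ , close) = splits δ 0<δ in n , d₁ , d₂ , trans (f≗g n) gn≡ , close

  splits : ∀ P → Monic P → HasDegree P 2 ⊎ HasDegree P 3 → ∀ {t} → 0ℚ ℚ.< t → Splits (eval P) t
  splits P monic (inj₁ deg) {t} 0<t =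
    let (a , b , P≗) = monic-quadratic P monic deg in splits-cong t P≗ (monic₂-splits a b 0<t)
  splits P monic (inj₂ deg) {t} 0<t =
    let (a , b , c , P≗) = monic-cubic P monic deg in splits-cong t P≗ (monic₃-splits a b c 0<t)

-- Passage from rational targets to real ones.

module RealLimit where

  open ℚ.≤-Reasoning
  open +-*-Solver

  -- For `d₂ = 0` the hypothesis would put an absolute value strictly below 0; otherwise `∣ D₂ ∣`
  -- cancels.
  quotient-close : ∀ d₁ d₂ c δ → ℚ.∣ fromℤ d₁ ℚ.- c ℚ.* fromℤ d₂ ∣ ℚ.< δ ℚ.* ℚ.∣ fromℤ d₂ ∣ →
    Σ[ d₂≢0 ∈ ℤ.NonZero d₂ ] ℚ.∣ quotient d₁ d₂ {{d₂≢0}} ℚ.- c ∣ ℚ.< δ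
  quotient-close d₁ d₂ c δ close with d₂ ℤ.≟ 0ℤ
  ... | yes refl = contradiction
    (ℚ.≤-<-trans (ℚ.0≤∣p∣ _) (ℚ.<-≤-trans close (ℚ.≤-reflexive (ℚ.*-zeroʳ δ)))) (ℚ.<-irrefl refl)
  ... | no d₂≢0  = nz , ℚ.*-cancelʳ-<-nonNeg ℚ.∣ D₂ ∣ {{ℚ.∣-∣-nonNeg D₂}} (begin-strict
    ℚ.∣ r ℚ.- c ∣ ℚ.* ℚ.∣ D₂ ∣    ≡⟨ ℚ.∣p*q∣≡∣p∣*∣q∣ (r ℚ.- c) D₂ ⟨
    ℚ.∣ (r ℚ.- c) ℚ.* D₂ ∣
      ≡⟨ cong ℚ.∣_∣ (solve 3 (λ r c d → (r :- c) :* d := r :* d :- c :* d) refl r c D₂) ⟩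
    ℚ.∣ r ℚ.* D₂ ℚ.- c ℚ.* D₂ ∣   ≡⟨ cong (λ z → ℚ.∣ z ℚ.- c ℚ.* D₂ ∣) rD₂≡D₁ ⟩
    ℚ.∣ D₁ ℚ.- c ℚ.* D₂ ∣         <⟨ close ⟩
    δ ℚ.* ℚ.∣ D₂ ∣                ∎)
    where
    D₁ = fromℤ d₁
    D₂ = fromℤ d₂
    nz = ℤ.≢-nonZero d₂≢0
    r = quotient d₁ d₂ {{nz}}
    rD₂≡D₁ : r ℚ.* D₂ ≡ D₁
    rD₂≡D₁ = trans (ℚ.*-assoc D₁ (ℚ.1/_ D₂ {{fromℤ-nonZero d₂ {{nz}}}}) D₂)
      (trans (cong (D₁ ℚ.*_) (ℚ.*-inverseˡ D₂ {{fromℤ-nonZero d₂ {{nz}}}})) (ℚ.*-identityʳ D₁))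

  1/-double : ∀ n → 1/[1+ double n ] ℚ.+ 1/[1+ double n ] ≡ 1/[1+ n ]
  1/-double n = lemma N 1/[1+ n ] 1/[1+ double n ] (fromℤ-1/ n)
    (trans (cong (ℚ._* 1/[1+ double n ]) N+N) (fromℤ-1/ (double n)))
    where
    N = fromℤ (+ suc n)
    N+N : N ℚ.+ N ≡ fromℤ (+ suc (double n))
    N+N = trans (sym (fromℤ-+ (+ suc n) (+ suc n))) (cong (λ k → fromℤ (+ suc k)) (ℕ.+-suc n n))
    lemma : ∀ N u v → N ℚ.* u ≡ 1ℚ → (N ℚ.+ N) ℚ.* v ≡ 1ℚ → v ℚ.+ v ≡ u
    lemma N u v Nu≡1 2Nv≡1 = begin-equality
      v ℚ.+ v                     ≡⟨ ℚ.*-identityʳ (v ℚ.+ v) ⟨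
      (v ℚ.+ v) ℚ.* 1ℚ            ≡⟨ cong ((v ℚ.+ v) ℚ.*_) Nu≡1 ⟨
      (v ℚ.+ v) ℚ.* (N ℚ.* u)     ≡⟨ solve 3 (λ N u v → (v :+ v) :* (N :* u) := (N :+ N) :* v :* u) refl N u v ⟩
      (N ℚ.+ N) ℚ.* v ℚ.* u       ≡⟨ trans (cong (ℚ._* u) 2Nv≡1) (ℚ.*-identityˡ u) ⟩
      u                           ∎

  -- A term of `α` may be slightly negative: `0ℝ ≤ α` bounds the term at `m₂` below only by `−t₁`.
  -- Adding `t₂ = 2 t₁` makes `a` strictly positive at the price of one more error `t₂`.
  rational-approximation : ∀ {α ε} → 0ℝ ≤ α → 0ℝ < ε →
    ∃[ a ] ∃[ δ ] (0ℚ ℚ.< a × 0ℚ ℚ.< δ × (∀ q → ℚ.∣ q ℚ.- a ∣ ℚ.< δ → ∣ fromℚ q - α ∣ < ε))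
  rational-approximation {α} {ε} 0≤α (n₀ , n₀-positive) =
    a , t₂ , 0<a , 0<1/[1+ k₃ ] , λ q q≈a → k₃ , (begin-strict
    t₂                                              ≡⟨ ℚ.+-identityʳ t₂ ⟨
    t₂ ℚ.+ 0ℚ                                       ≤⟨ ℚ.+-monoʳ-≤ t₂ (ℚ.<⇒≤ 0<1/[1+ m₁ ]) ⟩
    t₂ ℚ.+ t₁                                       ≡⟨ arithmetic ⟩
    t₅ ℚ.- ((t₄ ℚ.+ t₁) ℚ.+ (t₂ ℚ.+ t₂))
      <⟨ ℚ.+-mono-< ε-large (ℚ.neg-antimono-< (ℚ.+-mono-≤-< ε-stable (q≈α q q≈a))) ⟩
    E ℚ.- ((E ℚ.- seq ε m₁) ℚ.+ ℚ.∣ q ℚ.- seq α m₂ ∣)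
      ≡⟨ solve 3 (λ E e x → E :- ((E :- e) :+ x) := e :- x) refl E (seq ε m₁) ℚ.∣ q ℚ.- seq α m₂ ∣ ⟩
    seq ε m₁ ℚ.- ℚ.∣ q ℚ.- seq α m₂ ∣               ∎)
    where
    k₁ k₂ k₃ m₁ m₂ : ℕ
    -- Each subtraction of reals doubles the index: `0ℝ < ε` at `n₀` reads `ε` at `k₁`, and the
    -- conclusion at `k₃` reads `ε` at `m₁` and `α` at `m₂`. The extra doubling `k₂` supplies room:
    -- in units of `t₁` the losses are 8 + 1 + 4 out of 16, and the remaining 3 exceed the required
    -- 2. Without it they would be 4 + 1 + 4 out of 8.
    k₁ = double n₀
    k₂ = double k₁
    k₃ = double k₂
    m₁ = double k₃
    m₂ = double m₁
    -- t₂ = 2 t₁, t₄ = 8 t₁ and t₅ = 16 t₁, because 1/[1+ n ] = 2 · 1/[1+ double n ].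
    t₁ t₂ t₄ t₅ E a : ℚ
    t₁ = 1/[1+ m₁ ]
    t₂ = 1/[1+ k₃ ]
    t₄ = 1/[1+ k₁ ]
    t₅ = 1/[1+ n₀ ]
    E = seq ε k₁
    a = seq α m₂ ℚ.+ t₂
    arithmetic : t₂ ℚ.+ t₁ ≡ t₅ ℚ.- ((t₄ ℚ.+ t₁) ℚ.+ (t₂ ℚ.+ t₂))
    arithmetic = lemma (1/-double k₃) (1/-double k₂) (1/-double k₁) (1/-double n₀)
      where
      lemma : ∀ {t₁ t₂ t₃ t₄ t₅} → t₁ ℚ.+ t₁ ≡ t₂ → t₂ ℚ.+ t₂ ≡ t₃ → t₃ ℚ.+ t₃ ≡ t₄ → t₄ ℚ.+ t₄ ≡ t₅ →
        t₂ ℚ.+ t₁ ≡ t₅ ℚ.- ((t₄ ℚ.+ t₁) ℚ.+ (t₂ ℚ.+ t₂))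
      lemma {t₁} refl refl refl refl = solve 1 (λ t₁ → let t₂ = t₁ :+ t₁ ; t₃ = t₂ :+ t₂ ; t₄ = t₃ :+ t₃ in
        t₂ :+ t₁ := (t₄ :+ t₄) :- ((t₄ :+ t₁) :+ (t₂ :+ t₂))) refl t₁
    ε-large : t₅ ℚ.< E
    ε-large = ℚ.<-≤-trans n₀-positive (ℚ.≤-reflexive (ℚ.+-identityʳ E))
    ε-stable : E ℚ.- seq ε m₁ ℚ.≤ t₄ ℚ.+ t₁
    ε-stable = ℚ.≤-trans (p≤∣p∣ _) (regular ε k₁ m₁)
    0<a : 0ℚ ℚ.< a
    0<a = begin-strict
      0ℚ                        <⟨ 0<1/[1+ m₁ ] ⟩
      t₁                        ≡⟨ solve 1 (λ t → t := (:- t) :+ (t :+ t)) refl t₁ ⟩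
      ℚ.- t₁ ℚ.+ (t₁ ℚ.+ t₁)    ≡⟨ cong (ℚ._+_ (ℚ.- t₁)) (1/-double k₃) ⟩
      ℚ.- t₁ ℚ.+ t₂
        ≤⟨ ℚ.+-monoˡ-≤ t₂ (ℚ.≤-trans (0≤α m₁) (ℚ.≤-reflexive (ℚ.+-identityʳ (seq α m₂)))) ⟩
      a                         ∎
    q≈α : ∀ q → ℚ.∣ q ℚ.- a ∣ ℚ.< t₂ → ℚ.∣ q ℚ.- seq α m₂ ∣ ℚ.< t₂ ℚ.+ t₂
    q≈α q q≈a = begin-strict
      ℚ.∣ q ℚ.- seq α m₂ ∣                       ≤⟨ ∣-∣-triangle q a (seq α m₂) ⟩
      ℚ.∣ q ℚ.- a ∣ ℚ.+ ℚ.∣ a ℚ.- seq α m₂ ∣     <⟨ ℚ.+-monoˡ-< ℚ.∣ a ℚ.- seq α m₂ ∣ q≈a ⟩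
      t₂ ℚ.+ ℚ.∣ a ℚ.- seq α m₂ ∣
        ≡⟨ cong (λ z → t₂ ℚ.+ ℚ.∣ z ∣) (solve 2 (λ x t → (x :+ t) :- x := t) refl (seq α m₂) t₂) ⟩
      t₂ ℚ.+ ℚ.∣ t₂ ∣                            ≡⟨ cong (ℚ._+_ t₂) (ℚ.0≤p⇒∣p∣≡p (ℚ.<⇒≤ 0<1/[1+ k₃ ])) ⟩
      t₂ ℚ.+ t₂                                  ∎

theorem1 : (P : ℤ[x]) → Monic P → HasDegree P 2 ⊎ HasDegree P 3 →
    (α : ℝ) → 0ℝ ≤ α →
    (ε : ℝ) → 0ℝ < ε →
    ∃[ n ] ∃[ d₁ ] ∃[ d₂ ] Σ[ d₂≢0 ∈ NonZero d₂ ]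
    (eval P n ≡ d₁ * d₂ × ∣ fromℚ (quotient d₁ d₂ {{d₂≢0}}) - α ∣ < ε)
theorem1 P monic deg α 0≤α ε 0<ε =
  let (a , δ , 0<a , 0<δ , approximates) = RealLimit.rational-approximation {α} {ε} 0≤α 0<ε
      (n , d₁ , d₂ , Pn≡d₁d₂ , close) = Coefficients.splits P monic deg 0<a δ 0<δ
      (d₂≢0 , near) = RealLimit.quotient-close d₁ d₂ a δ close
  in n , d₁ , d₂ , d₂≢0 , Pn≡d₁d₂ , approximates (quotient d₁ d₂ {{d₂≢0}}) near
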